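{- If a function $f:\{0,1\}^\star\to\{0,1\}^\star$ is computable in polynomial time, then there exist a lambda-term $t$ and an integer $n$ such that $\vdash_{DLAL}t:W\multimap\S^nW$ and $t$ represents $f$.
   Context: Lambda-terms are those of the pure untyped lambda-calculus, with $\beta$-reduction. DLAL types: $A,B::=\alpha\mid A\multimap B\mid A\Rightarrow B\mid \S A\mid\forall\alpha.A$; $\S^nA$ is $A$ prefixed by $n$ symbols $\S$. The type of binary words is $W=\forall\alpha.(\alpha\multimap\alpha)\Rightarrow(\alpha\multimap\alpha)\Rightarrow\S(\alpha\multimap\alpha)$. A word $w=i_1\cdots i_k\in\{0,1\}^\star$ is encoded by the Church word $\underline w=\lambda s_0.\lambda s_1.\lambda x.\,s_{i_1}(s_{i_2}(\cdots(s_{i_k}\,x)\cdots))$. A term $t$ represents $f$ if for every $w\in\{0,1\}^\star$ the term $(t\,\underline w)$ $\beta$-reduces to $\underline{f(w)}$. $\vdash_{DLAL}t:A$ means that $;\vdash t:A$ (both environments empty) is derivable in the following system. Besides types there are discharged formulas $[A]_\S$ ($A$ a type), a technical device allowed only in environments, to the right of the semicolon; they cannot be abstracted. A judgment is $\Gamma;\Delta\vdash t:A$, where $\Gamma$ assigns types to (non-linear) variables, $\Delta$ assigns types or discharged formulas to (linear) variables; environments are finite and unordered, and a comma denotes union of environments with disjoint sets of variables. $A,B,C,B_i$ below denote types. DLAL typing rules (natural deduction NDLAL): (Id) $\;;x:A\vdash x:A$. ($\multimap$ i) from $\Gamma_1;\Delta_1,x:A\vdash t:B$ infer $\Gamma_1;\Delta_1\vdash\lambda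 x.t:A\multimap B$. ($\multimap$ e) from $\Gamma_1;\Delta_1\vdash t:A\multimap B$ and $\Gamma_2;\Delta_2\vdash u:A$ infer $\Gamma_1,\Gamma_2;\Delta_1,\Delta_2\vdash(t\,u):B$. ($\Rightarrow$ i) from $\Gamma_1,x:A;\Delta_1\vdash t:B$ infer $\Gamma_1;\Delta_1\vdash\lambda x.t:A\Rightarrow B$. ($\Rightarrow$ e) from $\Gamma_1;\Delta_1\vdash t:A\Rightarrow B$ and $;z:C\vdash u:A$ infer $\Gamma_1,z:C;\Delta_1\vdash(t\,u):B$; the right premise may also be $;\vdash u:A$, and then $z:C$ is absent from the conclusion. (Weak) from $\Gamma_1;\Delta_1\vdash t:A$ infer $\Gamma_1,\Gamma_2;\Delta_1,\Delta_2\vdash t:A$. (Cntr) from $x_1:A,x_2:A,\Gamma_1;\Delta_1\vdash t:B$ infer $x:A,\Gamma_1;\Delta_1\vdash t[x/x_1,x/x_2]:B$. ($\S$ i) from $;\Gamma,x_1:B_1,\dots,x_n:B_n\vdash t:A$ (all formulas on the left being types) infer $\Gamma;x_1:[B_1]_\S,\dots,x_n:[B_n]_\S\vdash t:\S A$. ($\S$ e) from $\Gamma_1;\Delta_1\vdash u:\S A$ and $\Gamma_2;x:[A]_\S,\Delta_2\vdash t:B$ infer $\Gamma_1,\Gamma_2;\Delta_1,\Delta_2\vdash t[u/x]:B$. ($\forall$ i) from $\Gamma_1;\Delta_1\vdash t:A$ infer $\Gamma_1;\Delta_1\vdash t:\forall\alpha.A$, provided $\alpha$ is not free in $\Gamma_1,\Delta_1$.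 ($\forall$ e) from $\Gamma_1;\Delta_1\vdash t:\forall\alpha.A$ infer $\Gamma_1;\Delta_1\vdash t:A[B/\alpha]$. -}

module Defs where

open import Data.Bool.Base using (Bool; true; false)
open import Data.Fin.Base using (Fin; zero; suc)
open import Data.Fin.Substitution using (Sub; Lift; TermSubst)
open import Data.List.Base as List using (List; []; _∷_; foldr; length)
open import Data.Maybe.Base using (Maybe; just; nothing)
open import Data.Nat.Base using (ℕ; zero; suc; _+_; _*_; _≤_)
open import Data.Product.Base using (Σ-syntax; ∃-syntax; _×_; _,_)
open import Data.Vec.Base as Vec using (Vec; []; _∷_; lookup; replicate; _[_]≔_)
open import Data.Vec.Relation.Binary.Pointwise.Inductive using (Pointwise)
open import Relation.Binary.Construct.Closure.ReflexiveTransitive using (Star)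
open import Relation.Binary.PropositionalEquality using (_≡_)

Word : Set
Word = List Bool

infixl 9 _·_

data Term (n : ℕ) : Set where
  var : (x : Fin n) → Term n
  ƛ   : (t : Term (suc n)) → Term n
  _·_ : (t u : Term n) → Term n

module TermApp {T : ℕ → Set} (l : Lift T Term) where
  open Lift l hiding (var)

  infixl 8 _/_

  _/_ : ∀ {m n} → Term m → Sub T m n → Term n
  var x   / ρ = lift (lookup ρ x)
  ƛ t     / ρ = ƛ (t / ρ ↑)
  (t · u) / ρ = (t / ρ) · (u / ρ)

termSubst : TermSubst Term
termSubst = record { var = var; app = TermApp._/_ }

infix 8 _[_]

_[_] : ∀ {n} → Term (suc n) → Term n → Term n
t [ u ] = t / sub u
  where open TermSubst termSubst using (_/_; sub)

infix 4 _→β_ _↠β_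

data _→β_ {n : ℕ} : Term n → Term n → Set where
  β  : ∀ {t u} → ƛ t · u →β t [ u ]
  ξ  : ∀ {t t′} → t →β t′ → ƛ t →β ƛ t′
  ·ˡ : ∀ {t t′ u} → t →β t′ → t · u →β t′ · u
  ·ʳ : ∀ {t u u′} → u →β u′ → t · u →β t · u′

_↠β_ : ∀ {n} → Term n → Term n → Set
_↠β_ = Star _→β_

-- Under the three abstractions, s₀, s₁ and x have indices 2, 1 and 0; the
-- letters 0 and 1 are false and true.

church : Word → Term 0
church w = ƛ (ƛ (ƛ (foldr (λ i t → var (s i) · t) (var zero) w)))
  where
  s : Bool → Fin 3
  s false = suc (suc zero)
  s true  = suc zero

_Represents_ : Term 0 → (Word → Word) → Set
t Represents f = ∀ w → t · church w ↠β church (f w)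

infixr 7 _⊸_ _⇒_
infix  8 §_

data Type (k : ℕ) : Set where
  var     : (α : Fin k) → Type k
  _⊸_ _⇒_ : (A B : Type k) → Type k
  §_      : (A : Type k) → Type k
  ∀̇_      : (A : Type (suc k)) → Type k

module TypeApp {T : ℕ → Set} (l : Lift T Type) where
  open Lift l hiding (var)

  infixl 8 _/_

  _/_ : ∀ {j k} → Type j → Sub T j k → Type k
  var α   / ρ = lift (lookup ρ α)
  (A ⊸ B) / ρ = (A / ρ) ⊸ (B / ρ)
  (A ⇒ B) / ρ = (A / ρ) ⇒ (B / ρ)
  (§ A)   / ρ = § (A / ρ)
  (∀̇ A)   / ρ = ∀̇ (A / ρ ↑)

typeSubst : TermSubst Type
typeSubst = record { var = var; app = TypeApp._/_ }

weakenType : ∀ {k} → Type k → Type (suc k)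
weakenType = TermSubst.weaken typeSubst

infix 8 _[_]ᵀ

_[_]ᵀ : ∀ {k} → Type (suc k) → Type k → Type k
A [ B ]ᵀ = A / sub B
  where open TermSubst typeSubst using (_/_; sub)

§^ : ∀ {k} → ℕ → Type k → Type k
§^ zero    A = A
§^ (suc n) A = § (§^ n A)

W : ∀ {k} → Type k
W = ∀̇ ((α ⊸ α) ⇒ (α ⊸ α) ⇒ § (α ⊸ α))
  where α = var zero

-- A pair Γ;Δ of environments is one vector that says, for each of the n
-- variables in scope, whether it is undeclared, or in Γ (nonlin A), or in Δ
-- with a type (lin A) or with a discharged formula [A]§ (disch A). In
-- particular Γ and Δ never declare the same variable.

data Hyp (k : ℕ) : Set where
  none              : Hyp k
  nonlin lin disch  : (A : Type k) → Hyp k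

Env : ℕ → ℕ → Set
Env k n = Vec (Hyp k) n

∅ : ∀ {k n} → Env k n
∅ = replicate _ none

infix 6 _↦_

_↦_ : ∀ {k n} → Fin n → Hyp k → Env k n
x ↦ h = ∅ [ x ]≔ h

-- Γ₁ ⊎ Γ₂ ≋ Γ: the environments Γ₁ and Γ₂ declare disjoint sets of variables
-- and Γ is their union.

infix 4 _⊎ʰ_≋_ _⊎_≋_

data _⊎ʰ_≋_ {k : ℕ} : Hyp k → Hyp k → Hyp k → Set where
  left  : ∀ {h} → h ⊎ʰ none ≋ h
  right : ∀ {h} → none ⊎ʰ h ≋ h

data _⊎_≋_ {k : ℕ} : ∀ {n} → Env k n → Env k n → Env k n → Set where
  []  : [] ⊎ [] ≋ []
  _∷_ : ∀ {n h₁ h₂ h} {Γ₁ Γ₂ Γ : Env k n} →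
        h₁ ⊎ʰ h₂ ≋ h → Γ₁ ⊎ Γ₂ ≋ Γ → (h₁ ∷ Γ₁) ⊎ (h₂ ∷ Γ₂) ≋ (h ∷ Γ)

-- A linear hypothesis of the premise of (§ i) becomes, at will, a non-linear
-- or a discharged one in the conclusion.

data §Hyp {k : ℕ} : Hyp k → Hyp k → Set where
  none   : §Hyp none none
  nonlin : ∀ {A} → §Hyp (lin A) (nonlin A)
  disch  : ∀ {A} → §Hyp (lin A) (disch A)

weakenHyp : ∀ {k} → Hyp k → Hyp (suc k)
weakenHyp none       = none
weakenHyp (nonlin A) = nonlin (weakenType A)
weakenHyp (lin A)    = lin (weakenType A)
weakenHyp (disch A)  = disch (weakenType A)

weakenEnv : ∀ {k n} → Env k n → Env (suc k) n
weakenEnv = Vec.map weakenHyp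

-- A variable bound or substituted away by a rule is the one with index 0 in
-- the premise. Contraction merges the variable 0 of its premise into another
-- variable x, which keeps its place; giving the merged variable a fresh name
-- instead is a renaming of this.

infix 3 _⊢_∶_

data _⊢_∶_ : ∀ {k n} → Env k n → Term n → Type k → Set where

  Id   : ∀ {k n} {A : Type k} (x : Fin n) →
         x ↦ lin A ⊢ var x ∶ A

  ⊸i   : ∀ {k n} {Γ : Env k n} {t A B} →
         lin A ∷ Γ ⊢ t ∶ B →
         Γ ⊢ ƛ t ∶ A ⊸ B

  ⊸e   : ∀ {k n} {Γ₁ Γ₂ Γ : Env k n} {t u A B} →
         Γ₁ ⊎ Γ₂ ≋ Γ →
         Γ₁ ⊢ t ∶ A ⊸ B →
         Γ₂ ⊢ u ∶ A →
         Γ ⊢ t · u ∶ B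

  ⇒i   : ∀ {k n} {Γ : Env k n} {t A B} →
         nonlin A ∷ Γ ⊢ t ∶ B →
         Γ ⊢ ƛ t ∶ A ⇒ B

  ⇒e   : ∀ {k n} {Γ₁ Γ : Env k n} {t u A B C} (z : Fin n) →
         Γ₁ ⊎ z ↦ nonlin C ≋ Γ →
         Γ₁ ⊢ t ∶ A ⇒ B →
         z ↦ lin C ⊢ u ∶ A →
         Γ ⊢ t · u ∶ B

  ⇒e∅  : ∀ {k n} {Γ : Env k n} {t u A B} →
         Γ ⊢ t ∶ A ⇒ B →
         ∅ ⊢ u ∶ A →
         Γ ⊢ t · u ∶ B

  Weak : ∀ {k n} {Γ₁ Γ₂ Γ : Env k n} {t A} →
         Γ₁ ⊎ Γ₂ ≋ Γ →
         Γ₁ ⊢ t ∶ A →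
         Γ ⊢ t ∶ A

  Cntr : ∀ {k n} {Γ : Env k n} {t A B} (x : Fin n) →
         lookup Γ x ≡ nonlin A →
         nonlin A ∷ Γ ⊢ t ∶ B →
         Γ ⊢ t [ var x ] ∶ B

  §i   : ∀ {k n} {Γ Γ′ : Env k n} {t A} →
         Pointwise §Hyp Γ Γ′ →
         Γ ⊢ t ∶ A →
         Γ′ ⊢ t ∶ § A

  §e   : ∀ {k n} {Γ₁ Γ₂ Γ : Env k n} {t u A B} →
         Γ₁ ⊎ Γ₂ ≋ Γ →
         Γ₁ ⊢ u ∶ § A →
         disch A ∷ Γ₂ ⊢ t ∶ B →
         Γ ⊢ t [ u ] ∶ B

  ∀i   : ∀ {k n} {Γ : Env k n} {t A} →
         weakenEnv Γ ⊢ t ∶ A →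
         Γ ⊢ t ∶ ∀̇ A

  ∀e   : ∀ {k n} {Γ : Env k n} {t A} (B : Type k) →
         Γ ⊢ t ∶ ∀̇ A →
         Γ ⊢ t ∶ A [ B ]ᵀ

infix 3 ⊢DLAL_∶_

⊢DLAL_∶_ : Term 0 → Type 0 → Set
⊢DLAL t ∶ A = ∅ ⊢ t ∶ A

data Symbol (k : ℕ) : Set where
  blank : Symbol k
  bit   : Bool → Symbol k
  aux   : Fin k → Symbol k

data Move : Set where
  left stay right : Move

-- The machine halts when δ is undefined.

record TM : Set where
  field
    states  : ℕ
    symbols : ℕ
    start   : Fin states
    δ       : Fin states → Symbol symbols →
              Maybe (Fin states × Symbol symbols × Move)

-- A two-way infinite tape: the scanned cell and the cells to its left and to
-- its right, nearest first. Cells beyond the end of a list are blank.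

record Tape (k : ℕ) : Set where
  constructor tape
  field
    lefts   : List (Symbol k)
    scanned : Symbol k
    rights  : List (Symbol k)

write : ∀ {k} → Symbol k → Tape k → Tape k
write a (tape ls _ rs) = tape ls a rs

move : ∀ {k} → Move → Tape k → Tape k
move left  (tape []       a rs)       = tape [] blank (a ∷ rs)
move left  (tape (l ∷ ls) a rs)       = tape ls l (a ∷ rs)
move stay  τ                          = τ
move right (tape ls       a [])       = tape (a ∷ ls) blank []
move right (tape ls       a (r ∷ rs)) = tape (a ∷ ls) r rs

inputTape : ∀ {k} → Word → Tape k
inputTape []      = tape [] blank []
inputTape (b ∷ w) = tape [] (bit b) (List.map bit w)

-- The output is the longest word over {0,1} written from the scanned cell
-- rightwards.

bits : ∀ {k} → List (Symbol k) → Word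
bits (bit b ∷ as) = b ∷ bits as
bits _            = []

output : ∀ {k} → Tape k → Word
output (tape _ a rs) = bits (a ∷ rs)

module _ (M : TM) where
  open TM M

  Config : Set
  Config = Fin states × Tape symbols

  step : Config → Maybe Config
  step (q , τ) with δ q (Tape.scanned τ)
  ... | nothing           = nothing
  ... | just (q′ , a , m) = just (q′ , move m (write a τ))

  initial : Word → Config
  initial w = start , inputTape w

  -- HaltsIn c n τ: from c, the machine halts after exactly n steps, with
  -- tape τ.

  data HaltsIn : Config → ℕ → Tape symbols → Set where
    halt : ∀ {q τ} → step (q , τ) ≡ nothing → HaltsIn (q , τ) 0 τ
    next : ∀ {c c′ n τ} → step c ≡ just c′ → HaltsIn c′ n τ → HaltsIn c (suc n) τ

  ComputesWithin : (Word → Word) → (ℕ → ℕ) → Set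
  ComputesWithin f T = ∀ w → ∃[ n ] ∃[ τ ]
    n ≤ T (length w) × HaltsIn (initial w) n τ × output τ ≡ f w

-- The polynomial with coefficients a₀, a₁, …, by Horner's scheme.

⟦_⟧ : List ℕ → ℕ → ℕ
⟦ as ⟧ n = foldr (λ a r → a + n * r) 0 as

PolynomialTime : (Word → Word) → Set
PolynomialTime f = Σ[ M ∈ TM ] Σ[ p ∈ List ℕ ] ComputesWithin M f ⟦ p ⟧

{-# OPTIONS --safe #-}
module Submission where

-- § is an applicative functor on closed terms, and a term of type W ⇒ A yields
-- one of type W ⊸ § A with the same values: fold the input into the function
-- v ↦ f v, rebuilding v letter by letter. Since nonlinear variables can be
-- contracted, a word can therefore be fed to several linear programs at the
-- price of a few §. Iterating concatenation gives Horner's scheme on lengths,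
-- hence a word as long as the time bound, which is then folded over the step
-- function of the machine.
--
-- That step must have a type L ⊸ L without §. The argument of a nonlinear
-- application has at most one variable, so configurations are Church lists
-- over one finite type of cells with a single constructor variable, and a step
-- is a sequential transducer. It moves from left to right one cell behind the
-- reading position, so that a move of the head to the left can still be
-- written, and adds a blank at both ends.

open import Defs
open import Data.Bool.Base using (Bool; true; false)
open import Data.Fin.Base using (Fin; zero; suc; _↑ˡ_; combine; remQuot)
open import Data.Fin.Properties using (remQuot-combine)
open import Data.Fin.Substitution using (Sub; Subs; Lift; TermSubst)
open import Data.Fin.Substitution.Lemmas using (TermLemmas)
open import Data.List.Base as List using (List; []; _∷_; foldr; length; replicate; _∷ʳ_)
import Data.List.Properties as List
open import Data.List.Properties using (foldr-++; ++-assoc; ++-identityʳ; length-++; length-replicate)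
open import Data.Maybe.Base using (Maybe; just; nothing; fromMaybe)
open import Data.Nat.Base using (ℕ; zero; suc; _+_; _*_; _≤_; z≤n; s≤s)
open import Data.Nat.Properties using (+-assoc; +-comm)
open import Data.Product.Base as Product using (Σ-syntax; ∃-syntax; _×_; _,_; proj₁)
open import Data.Vec.Base as Vec using ([]; _∷_; lookup; _++_)
open import Data.Vec.Properties using (map-∘; map-cong; lookup-map; map-++; map-replicate; lookup-++ˡ)
open import Data.Vec.Relation.Binary.Pointwise.Inductive as Pointwise using (Pointwise; []; _∷_)
open import Function.Base using (_∘_; id)
open import Relation.Binary.Construct.Closure.ReflexiveTransitive as Star using (ε; _◅_; _◅◅_)
open import Relation.Binary.PropositionalEquality hiding ([_])

-- Substitution lemmas for lambda-terms.

termLemmas : TermLemmas Term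
termLemmas = record
  { termSubst = termSubst
  ; app-var   = refl
  ; /✶-↑✶     = Lemma./✶-↑✶
  }
  where
  module Steps {T : ℕ → Set} (l : Lift T Term) where
    open TermSubst termSubst using (module Lifted)
    open Lifted l

    ƛ-/✶-↑✶ : ∀ k {m n t} (ρs : Subs T m n) →
              ƛ t /✶ ρs ↑✶ k ≡ ƛ (t /✶ ρs ↑✶ suc k)
    ƛ-/✶-↑✶ k ε        = refl
    ƛ-/✶-↑✶ k (ρ ◅ ρs) = cong (_/ _) (ƛ-/✶-↑✶ k ρs)

    ·-/✶-↑✶ : ∀ k {m n t u} (ρs : Subs T m n) →
              t · u /✶ ρs ↑✶ k ≡ (t /✶ ρs ↑✶ k) · (u /✶ ρs ↑✶ k)
    ·-/✶-↑✶ k ε        = refl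
    ·-/✶-↑✶ k (ρ ◅ ρs) = cong (_/ _) (·-/✶-↑✶ k ρs)

  module Lemma {T₁ T₂ : ℕ → Set} {l₁ : Lift T₁ Term} {l₂ : Lift T₂ Term} where
    open TermSubst termSubst using (module Lifted)
    open Lifted l₁ using () renaming (_↑✶_ to _↑✶₁_; _/✶_ to _/✶₁_)
    open Lifted l₂ using () renaming (_↑✶_ to _↑✶₂_; _/✶_ to _/✶₂_)

    /✶-↑✶ : ∀ {m n} (ρs₁ : Subs T₁ m n) (ρs₂ : Subs T₂ m n) →
            (∀ k x → var x /✶₁ ρs₁ ↑✶₁ k ≡ var x /✶₂ ρs₂ ↑✶₂ k) →
            ∀ k t → t /✶₁ ρs₁ ↑✶₁ k ≡ t /✶₂ ρs₂ ↑✶₂ k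
    /✶-↑✶ ρs₁ ρs₂ hyp k (var x) = hyp k x
    /✶-↑✶ ρs₁ ρs₂ hyp k (ƛ t)   = trans (Steps.ƛ-/✶-↑✶ l₁ k ρs₁)
      (trans (cong ƛ (/✶-↑✶ ρs₁ ρs₂ hyp (suc k) t)) (sym (Steps.ƛ-/✶-↑✶ l₂ k ρs₂)))
    /✶-↑✶ ρs₁ ρs₂ hyp k (t · u) = trans (Steps.·-/✶-↑✶ l₁ k ρs₁)
      (trans (cong₂ _·_ (/✶-↑✶ ρs₁ ρs₂ hyp k t) (/✶-↑✶ ρs₁ ρs₂ hyp k u))
             (sym (Steps.·-/✶-↑✶ l₂ k ρs₂)))

module Tm = TermLemmas termLemmas
open TermSubst termSubst using (_/_; _/Var_; weaken; sub; _↑)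

-- wkn zero c is c itself, not merely equal to it.
wkn : ∀ n → Term 0 → Term n
wkn zero    c = c
wkn (suc n) c = c / []

wkn-/[] : ∀ n c → wkn n c ≡ c / []
wkn-/[] zero    c = sym (Tm.id-vanishes c)
wkn-/[] (suc n) c = refl

wkn-/ : ∀ {m n} c {ρ : Sub Term m n} → wkn m c / ρ ≡ wkn n c
wkn-/ {m} {n} c {ρ} = trans (cong (_/ ρ) (wkn-/[] m c))
  (trans (sym (Tm./-⊙ c)) (sym (wkn-/[] n c)))

-- Closed constants make the reductions of terms with opaque parts computable:
-- nf leaves ⌞ c ⌟ alone and unfolds ⟪ t ⟫. The equations required by reduce
-- then hold by refl.
data Tpl (n : ℕ) : Set where
  var : (x : Fin n) → Tpl n
  ƛ   : (t : Tpl (suc n)) → Tpl n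
  _·_ : (t u : Tpl n) → Tpl n
  ⌞_⌟ : (c : Term 0) → Tpl n
  ⟪_⟫ : (t : Tpl 0) → Tpl n

module TplApp {T : ℕ → Set} (l : Lift T Tpl) where
  open Lift l hiding (var)

  app : ∀ {m n} → Tpl m → Sub T m n → Tpl n
  app (var x) ρ = lift (lookup ρ x)
  app (ƛ t)   ρ = ƛ (app t (ρ ↑ˡ))
    where _↑ˡ = Lift._↑ l
  app (t · u) ρ = app t ρ · app u ρ
  app ⌞ c ⌟   ρ = ⌞ c ⌟
  app ⟪ t ⟫   ρ = ⟪ t ⟫

tplSubst : TermSubst Tpl
tplSubst = record { var = var; app = TplApp.app }

module Tp = TermSubst tplSubst

infix 8 _[_]ᵗ

_[_]ᵗ : ∀ {n} → Tpl (suc n) → Tpl n → Tpl n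
t [ u ]ᵗ = t Tp./ Tp.sub u

inst : ∀ {n} → Tpl n → Term n
inst (var x)     = var x
inst (ƛ t)       = ƛ (inst t)
inst (t · u)     = inst t · inst u
inst {n} ⌞ c ⌟   = wkn n c
inst {n} ⟪ t ⟫   = wkn n (inst t)

inst-/Var : ∀ {m n} (t : Tpl m) (ρ : Sub Fin m n) → inst (t Tp./Var ρ) ≡ inst t /Var ρ
inst-/Var (var x) ρ = refl
inst-/Var (ƛ t)   ρ = cong ƛ (inst-/Var t _)
inst-/Var (t · u) ρ = cong₂ _·_ (inst-/Var t ρ) (inst-/Var u ρ)
inst-/Var {m} ⌞ c ⌟ ρ = sym (trans (Tm./Var≡/ {ρ = ρ} {t = wkn m c}) (wkn-/ {m} c))
inst-/Var {m} ⟪ t ⟫ ρ = sym (trans (Tm./Var≡/ {ρ = ρ} {t = wkn m (inst t)}) (wkn-/ {m} (inst t)))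

inst-/ : ∀ {m n} (t : Tpl m) (ρ : Sub Tpl m n) → inst (t Tp./ ρ) ≡ inst t / Vec.map inst ρ
inst-/ (var x) ρ = sym (lookup-map x inst ρ)
inst-/ (ƛ t)   ρ = cong ƛ (trans (inst-/ t (ρ Tp.↑)) (cong (λ ρ′ → inst t / (var zero ∷ ρ′)) eq))
  where
  eq : Vec.map inst (Vec.map Tp.weaken ρ) ≡ Vec.map weaken (Vec.map inst ρ)
  eq = trans (sym (map-∘ inst Tp.weaken ρ))
    (trans (map-cong (λ t → inst-/Var t _) ρ) (map-∘ weaken inst ρ))
inst-/ (t · u) ρ = cong₂ _·_ (inst-/ t ρ) (inst-/ u ρ)
inst-/ {m} ⌞ c ⌟ ρ = sym (wkn-/ {m} c)
inst-/ {m} ⟪ t ⟫ ρ = sym (wkn-/ {m} (inst t))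

map-inst-id : ∀ {n} → Vec.map inst (Tp.id {n}) ≡ Tm.id
map-inst-id {zero}  = refl
map-inst-id {suc n} = cong (var zero ∷_) (trans (sym (map-∘ inst Tp.weaken Tp.id))
    (trans (map-cong (λ t → inst-/Var t _) Tp.id) (trans (map-∘ weaken inst Tp.id) (cong (Vec.map weaken) map-inst-id))))

inst-[] : ∀ {n} (t : Tpl (suc n)) (u : Tpl n) → inst (t [ u ]ᵗ) ≡ inst t [ inst u ]
inst-[] t u = trans (inst-/ t (Tp.sub u)) (cong (λ ρ → inst t / (inst u ∷ ρ)) map-inst-id)

-- Reduction by evaluation of templates.

ƛ↠ : ∀ {n} {t t′ : Term (suc n)} → t ↠β t′ → ƛ t ↠β ƛ t′
ƛ↠ = Star.gmap ƛ ξ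

infixl 9 _·↠_

_·↠_ : ∀ {n} {t t′ u u′ : Term n} → t ↠β t′ → u ↠β u′ → t · u ↠β t′ · u′
p ·↠ q = Star.gmap (_· _) ·ˡ p ◅◅ Star.gmap (_ ·_) ·ʳ q

-- The number is fuel bounding the depth of recursion. A template that runs out of it is returned as
-- it stands, so soundness needs no termination argument, and the literals given to `reduce` need
-- only be large enough.
nf : ∀ {n} → ℕ → Tpl n → Tpl n
apply : ∀ {n} → ℕ → Tpl n → Tpl n → Tpl n

nf zero    t       = t
nf (suc k) (var x) = var x
nf (suc k) (ƛ t)   = ƛ (nf k t)
nf (suc k) (t · u) = apply k (nf k t) u
nf (suc k) ⌞ c ⌟   = ⌞ c ⌟
nf (suc k) ⟪ t ⟫   = nf k (t Tp./ [])

apply k (ƛ t)     u = nf k (t [ u ]ᵗ)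
apply k (var x)   u = var x · nf k u
apply k (t₁ · t₂) u = t₁ · t₂ · nf k u
apply k ⌞ c ⌟     u = ⌞ c ⌟ · nf k u
apply k ⟪ t ⟫     u = ⟪ t ⟫ · nf k u

nf-↠ : ∀ {n} k (t : Tpl n) → inst t ↠β inst (nf k t)
apply-↠ : ∀ {n} k (t u : Tpl n) → inst t · inst u ↠β inst (apply k t u)

nf-↠ zero    t       = ε
nf-↠ (suc k) (var x) = ε
nf-↠ (suc k) (ƛ t)   = ƛ↠ (nf-↠ k t)
nf-↠ (suc k) (t · u) = nf-↠ k t ·↠ ε ◅◅ apply-↠ k (nf k t) u
nf-↠ (suc k) ⌞ c ⌟   = ε
nf-↠ {n} (suc k) ⟪ t ⟫ = subst (_↠β inst (nf k (t Tp./ [])))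
  (trans (inst-/ t []) (sym (wkn-/[] n (inst t)))) (nf-↠ k (t Tp./ []))

apply-↠ k (ƛ t)     u = β ◅ subst (_↠β inst (nf k (t [ u ]ᵗ))) (inst-[] t u) (nf-↠ k (t [ u ]ᵗ))
apply-↠ k (var x)   u = ε ·↠ nf-↠ k u
apply-↠ k (t₁ · t₂) u = ε ·↠ nf-↠ k u
apply-↠ k ⌞ c ⌟     u = ε ·↠ nf-↠ k u
apply-↠ k ⟪ t ⟫     u = ε ·↠ nf-↠ k u

reduce : ∀ {n} k (t u : Tpl n) → nf k t ≡ u → inst t ↠β inst u
reduce k t u eq = subst (λ u → inst t ↠β inst u) eq (nf-↠ k t)

-- Derivations in larger scopes.

∅⊎∅ : ∀ {k n} → ∅ {k} {n} ⊎ ∅ ≋ ∅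
∅⊎∅ {n = zero}  = []
∅⊎∅ {n = suc n} = left ∷ ∅⊎∅

∅⊎_ : ∀ {k n} (Γ : Env k n) → ∅ ⊎ Γ ≋ Γ
∅⊎ []      = []
∅⊎ (h ∷ Γ) = right ∷ (∅⊎ Γ)

§∅ : ∀ {k n} → Pointwise §Hyp (∅ {k} {n}) (∅ {k} {n})
§∅ {n = zero}  = []
§∅ {n = suc n} = none ∷ §∅

∅-++ : ∀ {k} n m → ∅ {k} {n} ++ ∅ {n = m} ≡ ∅
∅-++ zero    m = refl
∅-++ (suc n) m = cong (none ∷_) (∅-++ n m)

↦-++ : ∀ {k n} m (x : Fin n) (h : Hyp k) → (x ↦ h) ++ ∅ ≡ (x ↑ˡ m) ↦ h
↦-++ {n = suc n} m zero    h = cong (h ∷_) (∅-++ n m)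
↦-++ {n = suc n} m (suc x) h = cong (none ∷_) (↦-++ m x h)

⊎-++ : ∀ {k n} m {Γ₁ Γ₂ Γ : Env k n} → Γ₁ ⊎ Γ₂ ≋ Γ → Γ₁ ++ ∅ {n = m} ⊎ Γ₂ ++ ∅ ≋ Γ ++ ∅
⊎-++ m []      = ∅⊎∅
⊎-++ m (s ∷ p) = s ∷ ⊎-++ m p

weakenEnv-++ : ∀ {k n} m (Γ : Env k n) → weakenEnv (Γ ++ ∅ {n = m}) ≡ weakenEnv Γ ++ ∅
weakenEnv-++ m Γ = trans (map-++ weakenHyp Γ ∅) (cong (weakenEnv Γ ++_) (map-replicate weakenHyp none m))

-- Every index is kept. Building the renaming from `_↑` makes its passage under a binder hold by
-- computation.
inject : ∀ n m → Sub Term n (n + m)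
inject zero    m = []
inject (suc n) m = inject n m ↑

lookup-inject : ∀ {n} m (x : Fin n) → lookup (inject n m) x ≡ var (x ↑ˡ m)
lookup-inject m zero            = refl
lookup-inject {suc n} m (suc x) = Tm.lookup-map-weaken x {ρ = inject n m} (lookup-inject m x)

-- The new variables come at the far end, away from the index 0 at which rules bind, so each rule
-- can be reapplied. In `Cntr` and `§e`, whose conclusions contain a substitution, the two
-- substitutions have to be commuted.
⊢-++ : ∀ {k n} m {Γ : Env k n} {t A} → Γ ⊢ t ∶ A → Γ ++ ∅ ⊢ t / inject n m ∶ A
⊢-++ {n = n} m (Id {A = A} x) =
  subst₂ (_⊢_∶ A) (sym (↦-++ m x (lin A))) (sym (lookup-inject m x)) (Id (x ↑ˡ m))
⊢-++ m (⊸i d)         = ⊸i (⊢-++ m d)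
⊢-++ m (⊸e p d e)     = ⊸e (⊎-++ m p) (⊢-++ m d) (⊢-++ m e)
⊢-++ m (⇒i d)         = ⇒i (⊢-++ m d)
⊢-++ m {Γ = Γ} (⇒e {Γ₁ = Γ₁} {C = C} z p d e) =
  ⇒e (z ↑ˡ m) (subst (Γ₁ ++ ∅ ⊎_≋ Γ ++ ∅) (↦-++ m z (nonlin C)) (⊎-++ m p)) (⊢-++ m d)
     (subst (_⊢ _ ∶ _) (↦-++ m z (lin C)) (⊢-++ m e))
⊢-++ {n = n} m (⇒e∅ d e)      = ⇒e∅ (⊢-++ m d) (subst (_⊢ _ ∶ _) (∅-++ n m) (⊢-++ m e))
⊢-++ m (Weak p d)     = Weak (⊎-++ m p) (⊢-++ m d)
⊢-++ {n = n} m {Γ = Γ} (Cntr {t = t} {B = B} x eq d) =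
  subst (Γ ++ ∅ ⊢_∶ B)
    (trans (cong (λ u → (t / inject n m ↑) [ u ]) (sym (lookup-inject m x)))
           (sym (Tm.sub-commutes t)))
    (Cntr (x ↑ˡ m) (trans (lookup-++ˡ Γ ∅ x) eq) (⊢-++ m d))
⊢-++ m (§i p d)       = §i (Pointwise.++⁺ p (§∅ {n = m})) (⊢-++ m d)
⊢-++ {n = n} m {Γ = Γ} (§e {t = t} {B = B} p d e) =
  subst (Γ ++ ∅ ⊢_∶ B) (sym (Tm.sub-commutes t)) (§e (⊎-++ m p) (⊢-++ m d) (⊢-++ m e))
⊢-++ m {Γ = Γ} (∀i d) = ∀i (subst (_⊢ _ ∶ _) (sym (weakenEnv-++ m Γ)) (⊢-++ m d))
⊢-++ m (∀e B d)       = ∀e B (⊢-++ m d)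

const : ∀ {k n c} {A : Type k} → ∅ ⊢ c ∶ A → ∅ ⊢ wkn n c ∶ A
const {n = zero}  d = d
const {n = suc n} d = ⊢-++ (suc n) d

⊸e∅ : ∀ {k n} {Γ : Env k n} {t u A B} → ∅ ⊢ t ∶ A ⊸ B → Γ ⊢ u ∶ A → Γ ⊢ t · u ∶ B
⊸e∅ = ⊸e (∅⊎ _)

-- Unification cannot recover `t` from a substituted term, and substitution does not compute on
-- opaque closed terms. With an explicit template, `t [ var x ]ᵗ` evaluates to the term wanted.
Cntrᵗ : ∀ {k n} {Γ : Env k n} {A B} (t : Tpl (suc n)) (x : Fin n) → lookup Γ x ≡ nonlin A →
        nonlin A ∷ Γ ⊢ inst t ∶ B → Γ ⊢ inst (t [ var x ]ᵗ) ∶ B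
Cntrᵗ {B = B} t x eq d = subst (_ ⊢_∶ B) (sym (inst-[] t (var x))) (Cntr x eq d)

§eᵗ : ∀ {k n} {Γ₁ Γ₂ Γ : Env k n} {A B} (t : Tpl (suc n)) (u : Tpl n) → Γ₁ ⊎ Γ₂ ≋ Γ →
      Γ₁ ⊢ inst u ∶ § A → disch A ∷ Γ₂ ⊢ inst t ∶ B → Γ ⊢ inst (t [ u ]ᵗ) ∶ B
§eᵗ {B = B} t u p d e = subst (_ ⊢_∶ B) (sym (inst-[] t u)) (§e p d e)

-- Church words as iterators.

spine : ∀ {X : Set} {n} → (X → Term n) → Term n → List X → Term n
spine h z = foldr (λ x t → h x · t) z

spine-/ : ∀ {X : Set} {m n} {h : X → Term m} {g : X → Term n} {z} (ρ : Sub Term m n) →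
          (∀ x → h x / ρ ≡ g x) → ∀ xs → spine h z xs / ρ ≡ spine g (z / ρ) xs
spine-/ ρ eq []       = refl
spine-/ ρ eq (x ∷ xs) = cong₂ _·_ (eq x) (spine-/ ρ eq xs)

if₀₁ : ∀ {X : Set} → X → X → Bool → X
if₀₁ a b false = a
if₀₁ a b true  = b

church-spine : ∀ {n} w → wkn n (church w) ≡
  ƛ (ƛ (ƛ (spine (if₀₁ (var (suc (suc zero))) (var (suc zero))) (var zero) w)))
church-spine {n} w = trans (wkn-/[] n (church w)) (cong (λ t → ƛ (ƛ (ƛ t))) (go w))
  where
  -- The letter map inside `church` is local to its definition; stripping the three abstractions
  -- makes the fold accessible without naming that map. The second clause is a dummy.
  body : ∀ {n} → Term n → Term (3 + n)
  body (ƛ (ƛ (ƛ t))) = t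
  body _             = var zero
  go : ∀ w → body (church w / []) ≡ spine (if₀₁ (var (suc (suc zero))) (var (suc zero))) (var zero) w
  go []          = refl
  go (false ∷ w) = cong (_ ·_) (go w)
  go (true  ∷ w) = cong (_ ·_) (go w)

≡⇒↠ : ∀ {n} {t u : Term n} → t ≡ u → t ↠β u
≡⇒↠ refl = ε

weaken²-/ : ∀ {n} (a b : Term n) → weaken (weaken a) / sub b ↑ ≡ weaken a
weaken²-/ a b = trans (Tm.weaken-↑ (weaken a) {ρ = sub b}) (cong weaken (Tm.weaken-sub a))

church-↠ : ∀ {n} w (a b c : Term n) → wkn n (church w) · a · b · c ↠β spine (if₀₁ a b) c w
church-↠ w a b c =
  ≡⇒↠ (cong (λ t → t · a · b · c) (church-spine w)) ◅◅
  ·ˡ (·ˡ β) ◅ ·ˡ β ◅ β ◅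
  -- One substitution per contraction; the weakenings that an argument picks up under the remaining
  -- binders are cancelled by the later substitutions.
  ≡⇒↠ (trans (cong (λ t → t / (sub b ↑) / sub c) (spine-/ (sub a ↑ ↑) (h≡ (weaken (weaken a)) _ refl refl) w))
      (trans (cong (_/ sub c) (spine-/ (sub b ↑) (h≡ (weaken a) (weaken b) (weaken²-/ a b) refl) w))
             (spine-/ (sub c) (h≡ a b (Tm.weaken-sub a) (Tm.weaken-sub b)) w)))
  where
  h≡ : ∀ {m n} {ρ : Sub Term m n} {t u} t′ u′ → t / ρ ≡ t′ → u / ρ ≡ u′ → ∀ i → if₀₁ t u i / ρ ≡ if₀₁ t′ u′ i
  h≡ _ _ p q false = p
  h≡ _ _ p q true  = q

v0 : ∀ {n} → Tpl (1 + n)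
v0 = var zero
v1 : ∀ {n} → Tpl (2 + n)
v1 = var (suc zero)
v2 : ∀ {n} → Tpl (3 + n)
v2 = var (suc (suc zero))
v3 : ∀ {n} → Tpl (4 + n)
v3 = var (suc (suc (suc zero)))
v4 : ∀ {n} → Tpl (5 + n)
v4 = var (suc (suc (suc (suc zero))))
v5 : ∀ {n} → Tpl (6 + n)
v5 = var (suc (suc (suc (suc (suc zero)))))

-- § is an applicative functor

η₁ : Tpl 0 → Tpl 0
η₁ t = ƛ (⟪ t ⟫ · v0)

η₂ : Tpl 0 → Tpl 0
η₂ t = ƛ (ƛ (⟪ t ⟫ · v1 · v0))

-- The § rules leave no constructor in the term, so one eta-expansion serves every `j`: `§e` opens
-- the argument and `§i` closes the result.
⊢η₁ : ∀ {k A B} {t : Tpl 0} j → ∅ {k} ⊢ inst t ∶ A ⊸ B → ∅ {k} ⊢ inst (η₁ t) ∶ §^ j A ⊸ §^ j B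
⊢η₁ {k} {A} {B} {t} j d = ⊸i (go j)
  where
  -- The scope `n` varies because the variable opened by `§e` stays behind undeclared.
  go : ∀ {n} j → lin (§^ j A) ∷ ∅ {k} {n} ⊢ inst (⟪ t ⟫ · v0) ∶ §^ j B
  go zero    = ⊸e∅ (const d) (Id zero)
  go (suc j) = §eᵗ (⟪ t ⟫ · v0) v0 (left ∷ ∅⊎∅) (Id zero) (§i (disch ∷ none ∷ §∅) (go j))

⊢η₂ : ∀ {k A B C} {t : Tpl 0} j → ∅ {k} ⊢ inst t ∶ A ⊸ B ⊸ C →
      ∅ {k} ⊢ inst (η₂ t) ∶ §^ j A ⊸ §^ j B ⊸ §^ j C
⊢η₂ {k} {A} {B} {C} {t} j d = ⊸i (⊸i (go j))
  where
  go : ∀ {n} j → lin (§^ j B) ∷ lin (§^ j A) ∷ ∅ {k} {n} ⊢ inst (⟪ t ⟫ · v1 · v0) ∶ §^ j C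
  go zero    = ⊸e (right ∷ left ∷ ∅⊎∅) (⊸e∅ (const d) (Id (suc zero))) (Id zero)
  go (suc j) = §eᵗ (⟪ t ⟫ · v0 · v1) v1 (right ∷ left ∷ ∅⊎∅) (Id (suc zero))
    (§eᵗ (⟪ t ⟫ · v1 · v0) v1 (right ∷ left ∷ left ∷ ∅⊎∅) (Id (suc zero))
      (§i (disch ∷ disch ∷ none ∷ none ∷ §∅) (go j)))

-- Words

comp : Tpl 0
comp = ƛ (ƛ (ƛ (v2 · (v1 · v0))))

⊢comp : ∀ {k} {A B C : Type k} → ∅ ⊢ inst comp ∶ (B ⊸ C) ⊸ (A ⊸ B) ⊸ A ⊸ C
⊢comp = ⊸i (⊸i (⊸i (⊸e (right ∷ right ∷ left ∷ []) (Id _) (⊸e (right ∷ left ∷ left ∷ []) (Id _) (Id _)))))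

append : Tpl 0
append = ƛ (ƛ (ƛ (ƛ (⟪ η₂ comp ⟫ · (v3 · v1 · v0) · (v2 · v1 · v0)))))

-- Both words receive the same letter variables, which are nonlinear and so may be contracted. The
-- two iterations have type § (α ⊸ α) and are composed under that single §.
⊢append : ∀ {k} → ∅ {k} ⊢ inst append ∶ W ⊸ W ⊸ W
⊢append = ⊸i (⊸i (∀i (⇒i (⇒i
  (Cntrᵗ (⟪ η₂ comp ⟫ · (v4 · v2 · v1) · (v3 · v2 · v0)) zero refl
  (Cntrᵗ (⟪ η₂ comp ⟫ · (v5 · v3 · v2) · (v4 · v0 · v1)) (suc (suc zero)) refl
  (⊸e (right ∷ right ∷ left ∷ left ∷ right ∷ left ∷ [])
    (⊸e∅ (const (⊢η₂ {t = comp} 1 ⊢comp))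
      (⇒e (suc (suc zero)) (left ∷ left ∷ right ∷ left ∷ left ∷ left ∷ [])
        (⇒e (suc (suc (suc zero))) (left ∷ left ∷ left ∷ right ∷ left ∷ left ∷ [])
          (∀e (var zero) (Id _)) (Id _)) (Id _)))
    (⇒e (suc zero) (left ∷ right ∷ left ∷ left ∷ left ∷ left ∷ [])
        (⇒e zero (right ∷ left ∷ left ∷ left ∷ left ∷ left ∷ [])
          (∀e (var zero) (Id _)) (Id _)) (Id _)))))))))

append-↠ : ∀ u v → inst append · church u · church v ↠β church (u List.++ v)
append-↠ u v =
  reduce 9 (append · ⌞ church u ⌟ · ⌞ church v ⌟)
           (ƛ (ƛ (ƛ (⌞ church u ⌟ · v2 · v1 · (⌞ church v ⌟ · v2 · v1 · v0))))) refl ◅◅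
  ƛ↠ (ƛ↠ (ƛ↠ (ε ·↠ church-↠ v s₀ s₁ x ◅◅ church-↠ u s₀ s₁ (spine (if₀₁ s₀ s₁) x v)))) ◅◅
  ≡⇒↠ (trans (cong (λ t → ƛ (ƛ (ƛ t))) (sym (foldr-++ _ x u v))) (sym (church-spine (u List.++ v))))
  where
  x s₀ s₁ : Term 3
  x  = var zero
  s₁ = var (suc zero)
  s₀ = var (suc (suc zero))

⊢empty : ∀ {k} → ∅ {k} ⊢ church [] ∶ W
⊢empty = ∀i (⇒i (⇒i (Weak (right ∷ right ∷ []) (§i (none ∷ none ∷ []) (⊸i (Id zero))))))

⊢letter : ∀ {k} b → ∅ {k} ⊢ church (b ∷ []) ∶ W
⊢letter false = ∀i (⇒i (⇒i (Weak (right ∷ left ∷ []) (§i (none ∷ nonlin ∷ [])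
  (⊸i (⊸e (right ∷ left ∷ left ∷ []) (Id (suc (suc zero))) (Id zero)))))))
⊢letter true  = ∀i (⇒i (⇒i (Weak (left ∷ right ∷ []) (§i (nonlin ∷ none ∷ [])
  (⊸i (⊸e (right ∷ left ∷ left ∷ []) (Id (suc zero)) (Id zero)))))))

cons snoc : Bool → Tpl 0
cons b = ƛ (⌞ inst append ⌟ · ⌞ church (b ∷ []) ⌟ · v0)
snoc b = ƛ (⌞ inst append ⌟ · v0 · ⌞ church (b ∷ []) ⌟)

⊢cons : ∀ {k} b → ∅ {k} ⊢ inst (cons b) ∶ W ⊸ W
⊢cons b = ⊸i (⊸e (right ∷ []) (⊸e∅ (const ⊢append) (const (⊢letter b))) (Id zero))

⊢snoc : ∀ {k} b → ∅ {k} ⊢ inst (snoc b) ∶ W ⊸ W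
⊢snoc b = ⊸i (⊸e (left ∷ []) (⊸e∅ (const ⊢append) (Id zero)) (const (⊢letter b)))

cons-↠ : ∀ b w → inst (cons b) · church w ↠β church (b ∷ w)
cons-↠ b w = reduce 5 (cons b · ⌞ church w ⌟) (⌞ inst append ⌟ · ⌞ church (b ∷ []) ⌟ · ⌞ church w ⌟) refl ◅◅
  append-↠ (b ∷ []) w

snoc-↠ : ∀ b w → inst (snoc b) · church w ↠β church (w List.++ b ∷ [])
snoc-↠ b w = reduce 5 (snoc b · ⌞ church w ⌟) (⌞ inst append ⌟ · ⌞ church w ⌟ · ⌞ church (b ∷ []) ⌟) refl ◅◅
  append-↠ w (b ∷ [])

⊢fold : ∀ {k n} {Γ : Env k n} {w f g B} → Γ ⊢ w ∶ W → ∅ ⊢ f ∶ B ⊸ B → ∅ ⊢ g ∶ B ⊸ B → Γ ⊢ w · f · g ∶ § (B ⊸ B)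
⊢fold {B = B} dw df dg = ⇒e∅ (⇒e∅ (∀e B dw) df) dg

iter : (f g z : Term 0) → Tpl 0
iter f g z = ƛ (⟪ η₁ (ƛ (v0 · ⌞ z ⌟)) ⟫ · (v0 · ⌞ f ⌟ · ⌞ g ⌟))

⊢iter : ∀ {k f g z} {B : Type k} → ∅ ⊢ f ∶ B ⊸ B → ∅ ⊢ g ∶ B ⊸ B → ∅ ⊢ z ∶ B → ∅ ⊢ inst (iter f g z) ∶ W ⊸ § B
⊢iter {z = z} df dg dz = ⊸i (⊸e∅ (const (⊢η₁ {t = ƛ (v0 · ⌞ z ⌟)} 1 (⊸i (⊸e (left ∷ []) (Id zero) (const dz)))))
  (⊢fold (Id zero) (const df) (const dg)))

iter-↠ : ∀ f g z w → inst (iter f g z) · church w ↠β spine (if₀₁ f g) z w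
iter-↠ f g z w = reduce 9 (iter f g z · ⌞ church w ⌟) (⌞ church w ⌟ · ⌞ f ⌟ · ⌞ g ⌟ · ⌞ z ⌟) refl ◅◅ church-↠ w f g z

-- W ⊸ §ᵏ W and W ⇒ A to W ⊸ § A

lift : Tpl 0
lift = iter (inst (cons false)) (inst (cons true)) (church [])

⊢lift : ∀ {k} → ∅ {k} ⊢ inst lift ∶ W ⊸ § W
⊢lift = ⊢iter (⊢cons false) (⊢cons true) ⊢empty

lift-↠ : ∀ w → inst lift · church w ↠β church w
lift-↠ w = iter-↠ (inst (cons false)) (inst (cons true)) (church []) w ◅◅ go w
  where
  go : ∀ w → spine (if₀₁ (inst (cons false)) (inst (cons true))) (church []) w ↠β church w
  go []          = ε
  go (false ∷ w) = ε ·↠ go w ◅◅ cons-↠ false w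
  go (true  ∷ w) = ε ·↠ go w ◅◅ cons-↠ true w

lifts : ℕ → Tpl 0
lifts zero    = ƛ v0
lifts (suc j) = ƛ (⟪ η₁ ⌞ inst (lifts j) ⌟ ⟫ · (⌞ inst lift ⌟ · v0))

⊢lifts : ∀ {k} j → ∅ {k} ⊢ inst (lifts j) ∶ W ⊸ §^ j W
⊢lifts zero    = ⊸i (Id zero)
⊢lifts (suc j) = ⊸i (⊸e∅ (const (⊢η₁ {t = ⌞ inst (lifts j) ⌟} 1 (⊢lifts j))) (⊸e∅ (const ⊢lift) (Id zero)))

lifts-↠ : ∀ j w → inst (lifts j) · church w ↠β church w
lifts-↠ zero    w = β ◅ ε
lifts-↠ (suc j) w = reduce 9 (lifts (suc j) · ⌞ church w ⌟) (⌞ inst (lifts j) ⌟ · (⌞ inst lift ⌟ · ⌞ church w ⌟)) refl ◅◅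
  ε ·↠ lift-↠ w ◅◅ lifts-↠ j w

-- The first letter's `push` is outermost in the fold and acts first, so adding letters at the end
-- of the accumulator restores the word in order. The argument has one variable, as `⇒e` demands.
push : Bool → Tpl 0
push b = ƛ (ƛ (v1 · (⌞ inst (snoc b) ⌟ · v0)))

⊢push : ∀ {k} {A : Type k} b → ∅ ⊢ inst (push b) ∶ (W ⇒ A) ⊸ W ⇒ A
⊢push b = ⊸i (⇒i (⇒e zero (right ∷ left ∷ []) (Id _) (⊸e∅ (const (⊢snoc b)) (Id _))))

coerce : Term 0 → Tpl 0
coerce f = ƛ (⟪ η₁ (ƛ (v0 · ⌞ f ⌟ · ⌞ church [] ⌟)) ⟫ · (v0 · ⌞ inst (push false) ⌟ · ⌞ inst (push true) ⌟))

⊢coerce : ∀ {k f} {A : Type k} → ∅ ⊢ f ∶ W ⇒ A → ∅ ⊢ inst (coerce f) ∶ W ⊸ § A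
⊢coerce {f = f} d = ⊸i (⊸e∅
  (const (⊢η₁ {t = ƛ (v0 · ⌞ f ⌟ · ⌞ church [] ⌟)} 1
    (⊸i (⇒e∅ (⊸e (left ∷ []) (Id zero) (const d)) (const ⊢empty)))))
  (⊢fold (Id zero) (const (⊢push false)) (const (⊢push true))))

coerce-↠ : ∀ f w → inst (coerce f) · church w ↠β f · church w
coerce-↠ f w = reduce 9 (coerce f · ⌞ church w ⌟)
    (⌞ church w ⌟ · ⌞ inst (push false) ⌟ · ⌞ inst (push true) ⌟ · ⌞ f ⌟ · ⌞ church [] ⌟) refl ◅◅
  church-↠ w (inst (push false)) (inst (push true)) f ·↠ ε ◅◅ go [] w
  where
  pushes : Word → Term 0
  pushes = spine (if₀₁ (inst (push false)) (inst (push true))) f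
  push-↠ : ∀ b w v → inst (push b) · pushes w · church v ↠β pushes w · church (v List.++ b ∷ [])
  push-↠ b w v = reduce 9 (push b · ⌞ pushes w ⌟ · ⌞ church v ⌟) (⌞ pushes w ⌟ · (⌞ inst (snoc b) ⌟ · ⌞ church v ⌟)) refl ◅◅
    ε ·↠ snoc-↠ b v
  go : ∀ v w → pushes w · church v ↠β f · church (v List.++ w)
  go v []          = ≡⇒↠ (cong (λ v → f · church v) (sym (++-identityʳ v)))
  go v (false ∷ w) = push-↠ false w v ◅◅ go (v List.++ false ∷ []) w ◅◅
    ≡⇒↠ (cong (λ v → f · church v) (++-assoc v (false ∷ []) w))
  go v (true ∷ w)  = push-↠ true w v ◅◅ go (v List.++ true ∷ []) w ◅◅
    ≡⇒↠ (cong (λ v → f · church v) (++-assoc v (true ∷ []) w))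

dup : Term 0 → Tpl 0
dup h = ƛ (⌞ h ⌟ · v0 · v0)

-- Two linear variables become nonlinear through `§i`, which costs one §, and can then be
-- contracted.
⊢dup : ∀ {k h} {A B : Type k} → ∅ ⊢ h ∶ A ⊸ A ⊸ B → ∅ ⊢ inst (dup h) ∶ A ⇒ § B
⊢dup {h = h} d = ⇒i (Cntrᵗ (⌞ h ⌟ · v1 · v0) zero refl
  (§i (nonlin ∷ nonlin ∷ []) (⊸e (right ∷ left ∷ []) (⊸e∅ (const d) (Id _)) (Id _))))

module _ (j : ℕ) (g p : Term 0) where

  pair : Tpl 0
  pair = ƛ (ƛ (⟪ η₂ ⌞ g ⌟ ⟫ · (⌞ inst (lifts j) ⌟ · v1) · (⌞ p ⌟ · v0)))

  bind : Tpl 0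
  bind = coerce (inst (dup (inst pair)))

  -- The input reaches `g` through `lifts j`, to meet the output of `p` at depth `j`. Of the two
  -- additional §, one is due to `dup` and one to `coerce`.
  ⊢bind : ∀ {k} {A : Type k} → ∅ {k} ⊢ g ∶ W ⊸ W ⊸ A → ∅ {k} ⊢ p ∶ W ⊸ §^ j W →
          ∅ {k} ⊢ inst bind ∶ W ⊸ § § §^ j A
  ⊢bind dg dp = ⊢coerce (⊢dup {h = inst pair} (⊸i (⊸i (⊸e (right ∷ left ∷ [])
    (⊸e∅ (const (⊢η₂ {t = ⌞ g ⌟} j dg)) (⊸e∅ (const (⊢lifts j)) (Id _))) (⊸e∅ (const dp) (Id _))))))

  bind-↠ : ∀ {u v} w → p · church w ↠β church u → g · church w · church u ↠β v →
           inst bind · church w ↠β v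
  bind-↠ w pw gwu = coerce-↠ (inst (dup (inst pair))) w ◅◅
    reduce 5 (dup (inst pair) · ⌞ church w ⌟) (⌞ inst pair ⌟ · ⌞ church w ⌟ · ⌞ church w ⌟) refl ◅◅
    reduce 9 (pair · ⌞ church w ⌟ · ⌞ church w ⌟) (⌞ g ⌟ · (⌞ inst (lifts j) ⌟ · ⌞ church w ⌟) · (⌞ p ⌟ · ⌞ church w ⌟)) refl ◅◅
    ε ·↠ lifts-↠ j w ·↠ pw ◅◅ gwu

§^-+ : ∀ {k} i j {A : Type k} → §^ i (§^ j A) ≡ §^ (i + j) A
§^-+ zero    j = refl
§^-+ (suc i) j = cong §_ (§^-+ i j)

-- Horner's scheme on the lengths of words

falses : ℕ → Term 0
falses zero    = church []
falses (suc a) = inst (cons false) · falses a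

⊢falses : ∀ {k} a → ∅ {k} ⊢ falses a ∶ W
⊢falses zero    = ⊢empty
⊢falses (suc a) = ⊸e∅ (⊢cons false) (⊢falses a)

falses-↠ : ∀ a → falses a ↠β church (replicate a false)
falses-↠ zero    = ε
falses-↠ (suc a) = ε ·↠ falses-↠ a ◅◅ cons-↠ false (replicate a false)

-- Words serve as unary numbers: only the length counts, so the letters of `w` are ignored and those
-- of `r` are arbitrary.
horner : ℕ → Word → Word → Word
horner a w r = foldr (λ _ → r List.++_) (replicate a false) w

length-horner : ∀ a w r → length (horner a w r) ≡ a + length w * length r
length-horner a []      r = trans (length-replicate a) (sym (+-comm a 0))
length-horner a (b ∷ w) r = trans (length-++ r) (trans (cong (length r +_) (length-horner a w r))
  (trans (sym (+-assoc (length r) a _)) (trans (cong (_+ length w * length r) (+-comm (length r) a)) (+-assoc a (length r) _))))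

-- The word `r` is nonlinear because it occurs in the steps for both letters; in each it is the sole
-- variable of a nonlinear argument.
mult : ℕ → Tpl 0
mult a = ƛ (ƛ (⟪ η₁ (ƛ (v0 · ⌞ falses a ⌟)) ⟫ · (v0 · (⌞ inst append ⌟ · v1) · (⌞ inst append ⌟ · v1))))

⊢mult : ∀ {k} a → ∅ {k} ⊢ inst (mult a) ∶ W ⇒ W ⊸ § W
⊢mult a = ⇒i (⊸i (Cntrᵗ
  (⟪ η₁ (ƛ (v0 · ⌞ falses a ⌟)) ⟫ · (v1 · (⌞ inst append ⌟ · v2) · (⌞ inst append ⌟ · v0))) (suc zero) refl
  (⊸e∅ (const (⊢η₁ {t = ƛ (v0 · ⌞ falses a ⌟)} 1 (⊸i (⊸e (left ∷ []) (Id zero) (const (⊢falses a))))))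
    (⇒e zero (right ∷ left ∷ left ∷ [])
      (⇒e (suc (suc zero)) (left ∷ left ∷ right ∷ []) (∀e W (Id _)) (⊸e∅ (const ⊢append) (Id _)))
      (⊸e∅ (const ⊢append) (Id _))))))

mult-↠ : ∀ a r w → inst (mult a) · church r · church w ↠β church (horner a w r)
mult-↠ a r w = reduce 9 (mult a · ⌞ church r ⌟ · ⌞ church w ⌟)
    (⌞ church w ⌟ · (⌞ inst append ⌟ · ⌞ church r ⌟) · (⌞ inst append ⌟ · ⌞ church r ⌟) · ⌞ falses a ⌟) refl ◅◅
  church-↠ w (inst append · church r) (inst append · church r) (falses a) ◅◅ go w
  where
  go : ∀ w → spine (if₀₁ (inst append · church r) (inst append · church r)) (falses a) w ↠β church (horner a w r)
  go []          = falses-↠ a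
  go (false ∷ w) = ε ·↠ go w ◅◅ append-↠ r (horner a w r)
  go (true  ∷ w) = ε ·↠ go w ◅◅ append-↠ r (horner a w r)

hornerStep : ℕ → Tpl 0
hornerStep a = ƛ (ƛ (⟪ η₂ (ƛ (ƛ (v1 · v0))) ⟫ · (⌞ inst (coerce (inst (mult a))) ⌟ · v0) · (⌞ inst lift ⌟ · v1)))

-- Applying `coerce` makes `mult` linear in `r` but puts the resulting function under a §; `lift`
-- brings `w` to the same depth.
⊢hornerStep : ∀ {k} a → ∅ {k} ⊢ inst (hornerStep a) ∶ W ⊸ W ⊸ §^ 2 W
⊢hornerStep a = ⊸i (⊸i (⊸e (left ∷ right ∷ [])
  (⊸e∅ (const (⊢η₂ {t = ƛ (ƛ (v1 · v0))} 1 (⊸i (⊸i (⊸e (right ∷ left ∷ []) (Id _) (Id _))))))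
    (⊸e∅ (const (⊢coerce (⊢mult a))) (Id _)))
  (⊸e∅ (const ⊢lift) (Id _))))

hornerStep-↠ : ∀ a w r → inst (hornerStep a) · church w · church r ↠β church (horner a w r)
hornerStep-↠ a w r = reduce 9 (hornerStep a · ⌞ church w ⌟ · ⌞ church r ⌟)
    (⌞ inst (coerce (inst (mult a))) ⌟ · ⌞ church r ⌟ · (⌞ inst lift ⌟ · ⌞ church w ⌟)) refl ◅◅
  coerce-↠ (inst (mult a)) r ·↠ lift-↠ w ◅◅ mult-↠ a r w

-- Each coefficient costs four §: two from `bind` and two from `hornerStep`.
clock : ∀ as → Σ[ t ∈ Term 0 ] Σ[ n ∈ ℕ ] (∅ {0} ⊢ t ∶ W ⊸ §^ n W) ×
        (∀ w → ∃[ v ] (t · church w ↠β church v) × length v ≡ ⟦ as ⟧ (length w))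
clock [] = inst (ƛ ⌞ church [] ⌟) , 0 , ⊸i (Weak (right ∷ []) (const ⊢empty)) , λ w →
  [] , reduce 5 (ƛ ⌞ church [] ⌟ · ⌞ church w ⌟) ⌞ church [] ⌟ refl , refl
clock (a ∷ as) with clock as
... | t , n , d , spec = inst (bind n (inst (hornerStep a)) t) , 2 + (n + 2) ,
  subst (λ A → ∅ ⊢ inst (bind n (inst (hornerStep a)) t) ∶ W ⊸ § § A) (§^-+ n 2) (⊢bind n (inst (hornerStep a)) t (⊢hornerStep a) d) ,
  λ w → let v , tw , eq = spec w in
    horner a w v , bind-↠ n (inst (hornerStep a)) t {u = v} w tw (hornerStep-↠ a w v) ,
    trans (length-horner a w v) (cong (λ l → a + length w * l) eq)

-- Reduction under substitution.

→β-/ : ∀ {m n} {t u : Term m} (ρ : Sub Term m n) → t →β u → t / ρ →β u / ρ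
→β-/ ρ (β {t} {u}) = subst (ƛ (t / ρ ↑) · (u / ρ) →β_) (sym (Tm.sub-commutes t)) β
→β-/ ρ (ξ s)       = ξ (→β-/ (ρ ↑) s)
→β-/ ρ (·ˡ s)      = ·ˡ (→β-/ ρ s)
→β-/ ρ (·ʳ s)      = ·ʳ (→β-/ ρ s)

↠-wkn : ∀ {c d} n → c ↠β d → wkn n c ↠β wkn n d
↠-wkn zero    s = s
↠-wkn (suc n) s = Star.gmap (_/ []) (→β-/ []) s

-- inst t / ρ, except that constants are not substituted into.
instˢ : ∀ {m n} → Tpl m → Sub Term m n → Term n
instˢ (var x)     ρ = lookup ρ x
instˢ (ƛ t)       ρ = ƛ (instˢ t (ρ ↑))
instˢ (t · u)     ρ = instˢ t ρ · instˢ u ρ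
instˢ {n = n} ⌞ c ⌟ ρ = wkn n c
instˢ {n = n} ⟪ t ⟫ ρ = wkn n (inst t)

instˢ≡/ : ∀ {m n} (t : Tpl m) (ρ : Sub Term m n) → instˢ t ρ ≡ inst t / ρ
instˢ≡/ (var x) ρ = refl
instˢ≡/ (ƛ t)   ρ = cong ƛ (instˢ≡/ t (ρ ↑))
instˢ≡/ (t · u) ρ = cong₂ _·_ (instˢ≡/ t ρ) (instˢ≡/ u ρ)
instˢ≡/ {m} ⌞ c ⌟ ρ = sym (wkn-/ {m} c)
instˢ≡/ {m} ⟪ t ⟫ ρ = sym (wkn-/ {m} (inst t))

-- Constants of templates stand for closed terms only; here the variables of the template stand for
-- arbitrary open terms.
reduceˢ : ∀ {m n} k (t u : Tpl m) (ρ : Sub Term m n) → nf k t ≡ u → instˢ t ρ ↠β instˢ u ρ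
reduceˢ k t u ρ eq = subst₂ _↠β_ (sym (instˢ≡/ t ρ)) (sym (instˢ≡/ u ρ))
  (Star.gmap (_/ ρ) (→β-/ ρ) (reduce k t u eq))

-- Finite types

-- Bounded Scott numerals: F (suc n) encodes 1 + F n. Case analysis is then linear and free of §,
-- and weakening discards the branch not taken.
F : ∀ {k} → ℕ → Type k
F zero    = ∀̇ var zero
F (suc n) = ∀̇ (var zero ⊸ (F n ⊸ var zero) ⊸ var zero)

module _ {T : ℕ → Set} (l : Lift T Type) (lift-zero : ∀ {k} → Lift.lift l (Lift.var l {suc k} zero) ≡ var zero) where

  -- `F n` is closed, but this is not visible by computation for a variable `n`. The arbitrary
  -- lifting covers both renamings and type substitutions.
  F-app : ∀ {j k} n (ρ : Sub T j k) → TypeApp._/_ l (F n) ρ ≡ F n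
  F-app zero    ρ = cong ∀̇_ lift-zero
  F-app (suc n) ρ = cong ∀̇_ (cong₂ _⊸_ lift-zero (cong₂ _⊸_ (cong₂ _⊸_ (F-app n _) lift-zero) lift-zero))

F-[]ᵀ : ∀ {k} n (A : Type k) → F n [ A ]ᵀ ≡ F n
F-[]ᵀ n A = F-app _ refl n _

elem : ∀ {n} → Fin n → Tpl 0
elem zero    = ƛ (ƛ v1)
elem (suc i) = ƛ (ƛ (v0 · ⌞ inst (elem i) ⌟))

⊢elem : ∀ {k n} (i : Fin n) → ∅ {k} ⊢ inst (elem i) ∶ F n
⊢elem zero    = ∀i (⊸i (⊸i (Weak (right ∷ left ∷ []) (Id (suc zero)))))
⊢elem (suc i) = ∀i (⊸i (⊸i (Weak (left ∷ right ∷ []) (⊸e (left ∷ left ∷ []) (Id zero) (const (⊢elem i))))))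

case : ∀ {n} → (Fin n → Term 0) → Tpl 0
case {zero}  ts = ƛ v0
case {suc n} ts = ƛ (v0 · ⌞ ts zero ⌟ · ⌞ inst (case (ts ∘ suc)) ⌟)

⊢case : ∀ {k n ts} {A : Type k} → (∀ (i : Fin n) → ∅ ⊢ ts i ∶ A) → ∅ ⊢ inst (case ts) ∶ F n ⊸ A
⊢case {n = zero}  {A = A} ds = ⊸i (∀e {A = var zero} A (Id zero))
⊢case {n = suc n} {ts} {A} ds = ⊸i (⊸e (left ∷ []) (⊸e (left ∷ [])
  (subst (λ B → _ ⊢ _ ∶ A ⊸ (B ⊸ A) ⊸ A) (F-[]ᵀ n A) (∀e {A = var zero ⊸ (F n ⊸ var zero) ⊸ var zero} A (Id zero)))
  (const (ds zero))) (const (⊢case (ds ∘ suc))))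

case-↠ : ∀ {n} (ts : Fin n → Term 0) i → inst (case ts) · inst (elem i) ↠β ts i
case-↠ {suc n} ts zero    = reduce 9 (case ts · elem {suc n} zero) ⌞ ts zero ⌟ refl
case-↠ {suc n} ts (suc i) = reduce 9 (case ts · elem (suc i)) (⌞ inst (case (ts ∘ suc)) ⌟ · ⌞ inst (elem i) ⌟) refl ◅◅
  case-↠ (ts ∘ suc) i

record Finite (X : Set) : Set where
  field
    size          : ℕ
    index         : X → Fin size
    element       : Fin size → X
    element-index : ∀ x → element (index x) ≡ x

  ⌜_⌝ : X → Term 0
  ⌜ x ⌝ = inst (elem (index x))

  ⊢⌜_⌝ : ∀ {k} x → ∅ {k} ⊢ ⌜ x ⌝ ∶ F size
  ⊢⌜ x ⌝ = ⊢elem (index x)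

  table : (X → Term 0) → Term 0
  table ts = inst (case (ts ∘ element))

  ⊢table : ∀ {k ts} {A : Type k} → (∀ x → ∅ ⊢ ts x ∶ A) → ∅ ⊢ table ts ∶ F size ⊸ A
  ⊢table ds = ⊢case (ds ∘ element)

  table-↠ : ∀ ts x → table ts · ⌜ x ⌝ ↠β ts x
  table-↠ ts x = subst (λ y → table ts · ⌜ x ⌝ ↠β ts y) (element-index x) (case-↠ (ts ∘ element) (index x))

-- Church lists over a finite alphabet

module Lists {X : Set} (finX : Finite X) where
  open Finite finX

  L : ∀ {k} → Type k
  L = ∀̇ ((F size ⊸ var zero ⊸ var zero) ⇒ § (var zero ⊸ var zero))

  L-weaken : ∀ {k} → weakenType (L {k}) ≡ L
  L-weaken = cong (λ A → ∀̇ ((A ⊸ var zero ⊸ var zero) ⇒ § (var zero ⊸ var zero))) (F-app _ refl size _)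

  ⊢L-elim : ∀ {k n} {Γ : Env k n} {t} B → Γ ⊢ t ∶ L → Γ ⊢ t ∶ (F size ⊸ B ⊸ B) ⇒ § (B ⊸ B)
  ⊢L-elim B d = subst (λ A → _ ⊢ _ ∶ (A ⊸ B ⊸ B) ⇒ § (B ⊸ B)) (F-[]ᵀ size B) (∀e B d)

  ⊢L-intro : ∀ {k t} → lin (L {suc k}) ∷ [] ⊢ t ∶ (F size ⊸ var zero ⊸ var zero) ⇒ § (var zero ⊸ var zero) →
             lin (L {k}) ∷ [] ⊢ t ∶ L
  ⊢L-intro {t = t} d = ∀i (subst (λ A → lin A ∷ [] ⊢ t ∶ (F size ⊸ var zero ⊸ var zero) ⇒ § (var zero ⊸ var zero)) (sym L-weaken) d)

  letters : ∀ {n} → Term n → X → Term n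
  letters {n} s c = s · wkn n ⌜ c ⌝

  list : List X → Term 0
  list cs = ƛ (ƛ (spine (letters (var (suc zero))) (var zero) cs))

  list-spine : ∀ {n} cs → wkn n (list cs) ≡ ƛ (ƛ (spine (letters (var (suc zero))) (var zero) cs))
  list-spine {n} cs = trans (wkn-/[] n (list cs))
    (cong (λ t → ƛ (ƛ t)) (spine-/ _ (λ c → cong (var (suc zero) ·_) (wkn-/ {2} ⌜ c ⌝)) cs))

  list-↠ : ∀ {n} cs (s z : Term n) → wkn n (list cs) · s · z ↠β spine (letters s) z cs
  list-↠ {n} cs s z = ≡⇒↠ (cong (λ t → t · s · z) (list-spine cs)) ◅◅ ·ˡ β ◅ β ◅
    ≡⇒↠ (trans (cong (_/ sub z) (spine-/ (sub s ↑) (λ c → cong (weaken s ·_) (wkn-/ {2 + n} ⌜ c ⌝)) cs))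
      (spine-/ (sub z) (λ c → cong₂ _·_ (Tm.weaken-sub s) (wkn-/ {1 + n} ⌜ c ⌝)) cs))

  ⊢nil : ∀ {k} → ∅ {k} ⊢ list [] ∶ L
  ⊢nil = ∀i (⇒i (Weak (right ∷ []) (§i (none ∷ []) (⊸i (Id zero)))))

  consL : X → Tpl 0
  consL c = ƛ (ƛ (⟪ η₂ comp ⟫ · (v0 · ⌞ ⌜ c ⌝ ⌟) · (v1 · v0)))

  ⊢consL : ∀ {k} c → ∅ {k} ⊢ inst (consL c) ∶ L ⊸ L
  ⊢consL c = ⊸i (⊢L-intro (⇒i (Cntrᵗ (⟪ η₂ comp ⟫ · (v0 · ⌞ ⌜ c ⌝ ⌟) · (v2 · v1)) zero refl
    (⊸e (left ∷ right ∷ right ∷ [])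
      (⊸e∅ (const (⊢η₂ {t = comp} 1 ⊢comp))
        (§i (nonlin ∷ none ∷ none ∷ []) (⊸e (left ∷ left ∷ left ∷ []) (Id _) (const ⊢⌜ c ⌝))))
      (⇒e (suc zero) (left ∷ right ∷ left ∷ []) (⊢L-elim (var zero) (Id _)) (Id _))))))

  consL-↠ : ∀ c cs → inst (consL c) · list cs ↠β list (c ∷ cs)
  consL-↠ c cs = reduce 9 (consL c · ⌞ list cs ⌟) (ƛ (ƛ (v1 · ⌞ ⌜ c ⌝ ⌟ · (⌞ list cs ⌟ · v1 · v0)))) refl ◅◅
    ƛ↠ (ƛ↠ (ε ·↠ list-↠ cs (var (suc zero)) (var zero)))

  -- Sequential transducers

  module Transducer {Q : Set} (finQ : Finite Q) (δ : X → Q → X × Q) (final : Q → X) (end : X) where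
    module Q = Finite finQ

    run : Q → List X → List X
    yield : X × Q → List X → List X
    -- The end of the input is read as one more letter, and the last state yields another: the
    -- output is two letters longer than the input.
    run q []       = let c′ , q′ = δ end q in c′ ∷ final q′ ∷ []
    run q (c ∷ cs) = yield (δ c q) cs
    yield (c′ , q′) cs = c′ ∷ run q′ cs

    couple : X × Q → Tpl 0
    couple (c , q) = ƛ (v0 · ⌞ ⌜ c ⌝ ⌟ · ⌞ Q.⌜ q ⌝ ⌟)

    δ̂ final̂ : Term 0
    δ̂     = table λ c → Q.table λ q → inst (couple (δ c q))
    final̂ = Q.table (⌜_⌝ ∘ final)

    ⊢δ̂ : ∀ {k} {A : Type k} → ∅ ⊢ δ̂ ∶ F size ⊸ F Q.size ⊸ (F size ⊸ F Q.size ⊸ A) ⊸ A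
    ⊢δ̂ = ⊢table λ c → Q.⊢table λ q → ⊢couple (δ c q)
      where
      ⊢couple : ∀ {k} {A : Type k} p → ∅ ⊢ inst (couple p) ∶ (F size ⊸ F Q.size ⊸ A) ⊸ A
      ⊢couple (c , q) = ⊸i (⊸e (left ∷ []) (⊸e (left ∷ []) (Id zero) (const ⊢⌜ c ⌝)) (const Q.⊢⌜ q ⌝))

    δ̂-↠ : ∀ c q → δ̂ · ⌜ c ⌝ · Q.⌜ q ⌝ ↠β inst (couple (δ c q))
    δ̂-↠ c q = table-↠ _ c ·↠ ε ◅◅ Q.table-↠ _ q

    -- A Church list is a right fold, while the state travels from left to right. Folding at type F
    -- Q.size ⊸ A makes the rest of the list a function of the state in which it is entered.
    step̂ : Tpl 0
    step̂ = ƛ (ƛ (ƛ (ƛ (⌞ δ̂ ⌟ · v2 · v0 · ƛ (ƛ (v5 · v1 · (v3 · v0)))))))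

    ⊢step̂ : ∀ {k} {A : Type k} → ∅ ⊢ inst step̂ ∶ (F size ⊸ A ⊸ A) ⊸ F size ⊸ (F Q.size ⊸ A) ⊸ F Q.size ⊸ A
    ⊢step̂ = ⊸i (⊸i (⊸i (⊸i (⊸e (left ∷ right ∷ left ∷ right ∷ [])
      (⊸e (right ∷ left ∷ left ∷ left ∷ []) (⊸e∅ (const ⊢δ̂) (Id _)) (Id _))
      (⊸i (⊸i (⊸e (right ∷ left ∷ left ∷ right ∷ left ∷ left ∷ [])
        (⊸e (left ∷ right ∷ left ∷ left ∷ left ∷ left ∷ []) (Id _) (Id _))
        (⊸e (right ∷ left ∷ left ∷ left ∷ left ∷ left ∷ []) (Id _) (Id _)))))))))

    step̂-↠ : ∀ {n} (s k : Term n) c q → let c′ , q′ = δ c q in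
      wkn n (inst step̂) · s · wkn n ⌜ c ⌝ · k · wkn n Q.⌜ q ⌝ ↠β letters s c′ · (k · wkn n Q.⌜ q′ ⌝)
    step̂-↠ {n} s k c q =
      reduceˢ 12 (⟪ step̂ ⟫ · v1 · ⌞ ⌜ c ⌝ ⌟ · v0 · ⌞ Q.⌜ q ⌝ ⌟)
        (⌞ δ̂ ⌟ · ⌞ ⌜ c ⌝ ⌟ · ⌞ Q.⌜ q ⌝ ⌟ · ƛ (ƛ (v3 · v1 · (v2 · v0)))) (k ∷ s ∷ []) refl ◅◅
      (≡⇒↠ (δ̂≡ n) ◅◅ ↠-wkn n (δ̂-↠ c q)) ·↠ ε ◅◅
      reduceˢ 12 (⟪ couple (δ c q) ⟫ · ƛ (ƛ (v3 · v1 · (v2 · v0))))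
        (v1 · ⌞ ⌜ _ ⌝ ⌟ · (v0 · ⌞ Q.⌜ _ ⌝ ⌟)) (k ∷ s ∷ []) refl
      where
      δ̂≡ : ∀ n → wkn n δ̂ · wkn n ⌜ c ⌝ · wkn n Q.⌜ q ⌝ ≡ wkn n (δ̂ · ⌜ c ⌝ · Q.⌜ q ⌝)
      δ̂≡ zero    = refl
      δ̂≡ (suc n) = refl

    base : Tpl 0
    base = ƛ (ƛ (ƛ (⌞ inst step̂ ⌟ · v2 · ⌞ ⌜ end ⌝ ⌟ · ƛ (v2 · (⌞ final̂ ⌟ · v0) · v1))))

    -- The constructor is taken twice, once for each of the two letters written at the end.
    ⊢base : ∀ {k} {A : Type k} → ∅ ⊢ inst base ∶
      (F size ⊸ A ⊸ A) ⊸ (F size ⊸ A ⊸ A) ⊸ A ⊸ F Q.size ⊸ A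
    ⊢base = ⊸i (⊸i (⊸i (⊸e (right ∷ right ∷ left ∷ [])
      (⊸e (left ∷ left ∷ left ∷ []) (⊸e∅ (const ⊢step̂) (Id _)) (const ⊢⌜ end ⌝))
      (⊸i (⊸e (left ∷ right ∷ left ∷ left ∷ [])
        (⊸e (right ∷ left ∷ left ∷ left ∷ []) (Id _) (⊸e∅ (const (Q.⊢table (λ q → ⊢⌜ final q ⌝))) (Id _)))
        (Id _))))))

    feed : Q → Tpl 0
    feed q₀ = ƛ (ƛ (ƛ (v2 · (v1 · v0) · ⌞ Q.⌜ q₀ ⌝ ⌟)))

    ⊢feed : ∀ {k} {A B : Type k} q₀ → ∅ ⊢ inst (feed q₀) ∶ ((F Q.size ⊸ A) ⊸ F Q.size ⊸ A) ⊸ (B ⊸ F Q.size ⊸ A) ⊸ B ⊸ A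
    ⊢feed q₀ = ⊸i (⊸i (⊸i (⊸e (left ∷ left ∷ left ∷ [])
      (⊸e (right ∷ right ∷ left ∷ []) (Id _) (⊸e (right ∷ left ∷ left ∷ []) (Id _) (Id _))) (const Q.⊢⌜ q₀ ⌝))))

    transduce : Q → Tpl 0
    transduce q₀ = ƛ (ƛ (⟪ η₂ (feed q₀) ⟫ · (v1 · (⌞ inst step̂ ⌟ · v0)) · (⌞ inst base ⌟ · v0 · v0)))

    -- The fold over the input is under a §, and `§i` puts `base` under one too. They are combined
    -- within the § already present in `L`, so none is added.
    ⊢transduce : ∀ {k} q₀ → ∅ {k} ⊢ inst (transduce q₀) ∶ L ⊸ L
    ⊢transduce q₀ = ⊸i (⊢L-intro (⇒i
      -- Three copies of the constructor variable: one is the sole variable of a nonlinear argument,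
      -- and the two in `base` become nonlinear through `§i`.
      (Cntrᵗ (⟪ η₂ (feed q₀) ⟫ · (v2 · (⌞ inst step̂ ⌟ · v1)) · (⌞ inst base ⌟ · v1 · v0)) zero refl
      (Cntrᵗ (⟪ η₂ (feed q₀) ⟫ · (v3 · (⌞ inst step̂ ⌟ · v2)) · (⌞ inst base ⌟ · v0 · v1)) (suc zero) refl
      (⊸e (right ∷ right ∷ left ∷ left ∷ [])
        (⊸e∅ (const (⊢η₂ {t = feed q₀} 1 (⊢feed q₀)))
          (⇒e (suc (suc zero)) (left ∷ left ∷ right ∷ left ∷ []) (⊢L-elim (F Q.size ⊸ var zero) (Id _)) (⊸e∅ (const ⊢step̂) (Id _))))
        (§i (nonlin ∷ nonlin ∷ none ∷ none ∷ [])
          (⊸e (left ∷ right ∷ left ∷ left ∷ []) (⊸e∅ (const ⊢base) (Id _)) (Id _))))))))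

    transduce-↠ : ∀ q₀ cs → inst (transduce q₀) · list cs ↠β list (run q₀ cs)
    transduce-↠ q₀ cs =
      reduce 15 (transduce q₀ · ⌞ list cs ⌟)
        (ƛ (ƛ (⌞ list cs ⌟ · (⌞ inst step̂ ⌟ · v1) · (⌞ inst base ⌟ · v1 · v1 · v0) · ⌞ Q.⌜ q₀ ⌝ ⌟))) refl ◅◅
      ƛ↠ (ƛ↠ (list-↠ cs _ _ ·↠ ε ◅◅ go q₀ cs))
      where
      s x : Term 2
      s = var (suc zero)
      x = var zero
      go : ∀ q cs → spine (letters (wkn 2 (inst step̂) · s)) (wkn 2 (inst base) · s · s · x) cs · wkn 2 Q.⌜ q ⌝ ↠β
                    spine (letters s) x (run q cs)
      go q [] = reduce 9 (⟪ base ⟫ · v1 · v1 · v0) (⌞ inst step̂ ⌟ · v1 · ⌞ ⌜ end ⌝ ⌟ · ƛ (v2 · (⌞ final̂ ⌟ · v0) · v1)) refl ·↠ ε ◅◅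
        step̂-↠ s _ end q ◅◅
        ε ·↠ (reduce 9 (ƛ (v2 · (⌞ final̂ ⌟ · v0) · v1) · ⌞ Q.⌜ _ ⌝ ⌟) (v1 · (⌞ final̂ ⌟ · ⌞ Q.⌜ _ ⌝ ⌟) · v0) refl ◅◅
              ε ·↠ ↠-wkn 2 (Q.table-↠ (⌜_⌝ ∘ final) _) ·↠ ε)
      go q (c ∷ cs) = step̂-↠ s _ c q ◅◅ ε ·↠ go _ cs

  -- Reading a word off a list

  data Action : Set where
    skip stop : Action
    emit      : Bool → Action

  module Reader (act : X → Bool → Action) where

    -- The flag handed to the continuation tells whether the output has begun.
    perform : Action → (Bool → Word) → Word
    perform skip     k = k false
    perform stop     k = []
    perform (emit b) k = b ∷ k true

    read : List X → Bool → Word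
    read []       _ = []
    read (c ∷ cs) q = perform (act c q) (read cs)

    finBool : Finite Bool
    finBool = record
      { size = 2
      ; index = λ where
          false → zero
          true  → suc zero
      ; element = λ where
          zero       → false
          (suc zero) → true
      ; element-index = λ where
          false → refl
          true  → refl
      }

    module B = Finite finBool

    perform̂ : Action → Tpl 0
    perform̂ skip     = ƛ (v0 · ⌞ B.⌜ false ⌝ ⌟)
    perform̂ stop     = ƛ ⌞ church [] ⌟
    perform̂ (emit b) = ƛ (⌞ inst (cons b) ⌟ · (v0 · ⌞ B.⌜ true ⌝ ⌟))

    ⊢perform̂ : ∀ {k} a → ∅ {k} ⊢ inst (perform̂ a) ∶ (F 2 ⊸ W) ⊸ W
    ⊢perform̂ skip     = ⊸i (⊸e (left ∷ []) (Id _) (const B.⊢⌜ false ⌝))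
    ⊢perform̂ stop     = ⊸i (Weak (right ∷ []) (const ⊢empty))
    ⊢perform̂ (emit b) = ⊸i (⊸e∅ (const (⊢cons b)) (⊸e (left ∷ []) (Id _) (const B.⊢⌜ true ⌝)))

    perform̂-↠ : ∀ a t k → (∀ q → t · B.⌜ q ⌝ ↠β church (k q)) → inst (perform̂ a) · t ↠β church (perform a k)
    perform̂-↠ skip     t k h = reduce 9 (perform̂ skip · ⌞ t ⌟) (⌞ t ⌟ · ⌞ B.⌜ false ⌝ ⌟) refl ◅◅ h false
    perform̂-↠ stop     t k h = reduce 9 (perform̂ stop · ⌞ t ⌟) ⌞ church [] ⌟ refl
    perform̂-↠ (emit b) t k h = reduce 9 (perform̂ (emit b) · ⌞ t ⌟) (⌞ inst (cons b) ⌟ · (⌞ t ⌟ · ⌞ B.⌜ true ⌝ ⌟)) refl ◅◅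
      ε ·↠ h true ◅◅ cons-↠ b (k true)

    actions : X → Bool → Term 0
    actions c q = inst (perform̂ (act c q))

    act̂ : Term 0
    act̂ = table λ c → B.table (actions c)

    ⊢act̂ : ∀ {k} → ∅ {k} ⊢ act̂ ∶ F size ⊸ F 2 ⊸ (F 2 ⊸ W) ⊸ W
    ⊢act̂ = ⊢table {ts = λ c → B.table (actions c)} λ c → B.⊢table {ts = actions c} λ q → ⊢perform̂ (act c q)

    act̂-↠ : ∀ c q → act̂ · ⌜ c ⌝ · B.⌜ q ⌝ ↠β actions c q
    act̂-↠ c q = table-↠ (λ c → B.table (actions c)) c ·↠ ε ◅◅ B.table-↠ (actions c) q

    readStep : Tpl 0
    readStep = ƛ (ƛ (ƛ (⌞ act̂ ⌟ · v2 · v0 · v1)))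

    ⊢readStep : ∀ {k} → ∅ {k} ⊢ inst readStep ∶ F size ⊸ (F 2 ⊸ W) ⊸ F 2 ⊸ W
    ⊢readStep = ⊸i (⊸i (⊸i (⊸e (left ∷ right ∷ left ∷ [])
      (⊸e (right ∷ left ∷ left ∷ []) (⊸e∅ (const ⊢act̂) (Id _)) (Id _)) (Id _))))

    reader : Tpl 0
    reader = ƛ (⟪ η₁ (ƛ (v0 · ⟪ ƛ ⌞ church [] ⌟ ⟫ · ⌞ B.⌜ false ⌝ ⌟)) ⟫ · (v0 · ⌞ inst readStep ⌟))

    ⊢reader : ∀ {k} → ∅ {k} ⊢ inst reader ∶ L ⊸ § W
    ⊢reader = ⊸i (⊸e∅
      (const (⊢η₁ {t = ƛ (v0 · ⟪ ƛ ⌞ church [] ⌟ ⟫ · ⌞ B.⌜ false ⌝ ⌟)} 1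
        (⊸i (⊸e (left ∷ []) (⊸e (left ∷ []) (Id zero) (const (⊸i (Weak (right ∷ []) (const ⊢empty))))) (const B.⊢⌜ false ⌝)))))
      (⇒e∅ (⊢L-elim (F 2 ⊸ W) (Id zero)) (const ⊢readStep)))

    reader-↠ : ∀ cs → inst reader · list cs ↠β church (read cs false)
    reader-↠ cs =
      reduce 9 (reader · ⌞ list cs ⌟) (⌞ list cs ⌟ · ⌞ inst readStep ⌟ · (ƛ ⌞ church [] ⌟) · ⌞ B.⌜ false ⌝ ⌟) refl ◅◅
      list-↠ cs _ _ ·↠ ε ◅◅ go cs false
      where
      go : ∀ cs q → spine (letters (inst readStep)) (inst (ƛ ⌞ church [] ⌟)) cs · B.⌜ q ⌝ ↠β church (read cs q)
      go [] q = reduce 3 (ƛ ⌞ church [] ⌟ · ⌞ B.⌜ q ⌝ ⌟) ⌞ church [] ⌟ refl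
      go (c ∷ cs) q = reduce 9 (readStep · ⌞ ⌜ c ⌝ ⌟ · ⌞ rest ⌟ · ⌞ B.⌜ q ⌝ ⌟) (⌞ act̂ ⌟ · ⌞ ⌜ c ⌝ ⌟ · ⌞ B.⌜ q ⌝ ⌟ · ⌞ rest ⌟) refl ◅◅
        act̂-↠ c q ·↠ ε ◅◅ perform̂-↠ (act c q) rest (read cs) (go cs)
        where
        rest : Term 0
        rest = spine (letters (inst readStep)) (inst (ƛ ⌞ church [] ⌟)) cs

-- Finite sets of cells and states.

finFin : ∀ n → Finite (Fin n)
finFin n = record { size = n ; index = id ; element = id ; element-index = λ _ → refl }

finMaybe : ∀ {X} → Finite X → Finite (Maybe X)
finMaybe fin = record
  { size = suc size
  ; index = λ where
      nothing  → zero
      (just x) → suc (index x)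
  ; element = λ where
      zero    → nothing
      (suc i) → just (element i)
  ; element-index = λ where
      nothing  → refl
      (just x) → cong just (element-index x)
  }
  where open Finite fin

finProduct : ∀ {X Y} → Finite X → Finite Y → Finite (X × Y)
finProduct finX finY = record
  { size = X.size * Y.size
  ; index = λ (x , y) → combine (X.index x) (Y.index y)
  ; element = λ i → Product.map X.element Y.element (remQuot Y.size i)
  ; element-index = λ (x , y) →
      trans (cong (Product.map X.element Y.element) (remQuot-combine (X.index x) (Y.index y)))
            (cong₂ _,_ (X.element-index x) (Y.element-index y))
  }
  where
  module X = Finite finX
  module Y = Finite finY

finSymbol : ∀ k → Finite (Symbol k)
finSymbol k = record
  { size = 3 + k
  ; index = λ where
      blank       → zero
      (bit false) → suc zero
      (bit true)  → suc (suc zero)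
      (aux a)     → suc (suc (suc a))
  ; element = λ where
      zero                → blank
      (suc zero)          → bit false
      (suc (suc zero))    → bit true
      (suc (suc (suc a))) → aux a
  ; element-index = λ where
      blank       → refl
      (bit false) → refl
      (bit true)  → refl
      (aux a)     → refl
  }

-- Tapes up to trailing blanks.

-- Every run of the transducer adds a blank at both ends, so cell lists match tapes only up to
-- blanks beyond their ends.
data Padded {k} : List (Symbol k) → List (Symbol k) → Set where
  []  : Padded [] []
  pad : ∀ {bs} → Padded [] bs → Padded [] (blank ∷ bs)
  _∷_ : ∀ {as bs} a → Padded as bs → Padded (a ∷ as) (a ∷ bs)

Padded-refl : ∀ {k} (as : List (Symbol k)) → Padded as as
Padded-refl []       = []
Padded-refl (a ∷ as) = a ∷ Padded-refl as

Padded-∷ʳ : ∀ {k} {as bs : List (Symbol k)} → Padded as bs → Padded as (bs ∷ʳ blank)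
Padded-∷ʳ []      = pad []
Padded-∷ʳ (pad p) = pad (Padded-∷ʳ p)
Padded-∷ʳ (a ∷ p) = a ∷ Padded-∷ʳ p

bits-Padded : ∀ {k} {as bs : List (Symbol k)} → Padded as bs → bits bs ≡ bits as
bits-Padded []          = refl
bits-Padded (pad p)     = refl
bits-Padded (blank ∷ p) = refl
bits-Padded (bit b ∷ p) = cong (b ∷_) (bits-Padded p)
bits-Padded (aux a ∷ p) = refl

-- Turing machine steps as transductions.

module Simulation (M : TM) where
  open TM M

  -- A cell carries the machine state if the head is on it. A transducer state holds the cell read
  -- but not yet written and, after a move to the right, the machine state to be placed on the next
  -- cell.
  Cell State : Set
  Cell  = Symbol symbols × Maybe (Fin states)
  State = Cell × Maybe (Fin states)

  finCell : Finite Cell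
  finCell = finProduct (finSymbol symbols) (finMaybe (finFin states))

  finState : Finite State
  finState = finProduct finCell (finMaybe (finFin states))

  plain : Symbol symbols → Cell
  plain a = a , nothing

  respond : Symbol symbols → Fin states → Cell → Maybe (Fin states × Symbol symbols × Move) → Cell × State
  respond a q d nothing                  = d , (a , just q) , nothing
  respond a q d (just (q′ , a′ , left))  = (proj₁ d , just q′) , plain a′ , nothing
  respond a q d (just (q′ , a′ , stay))  = d , (a′ , just q′) , nothing
  respond a q d (just (q′ , a′ , right)) = d , plain a′ , just q′

  transition : Cell → State → Cell × State
  transition (a , nothing) (d , h) = d , (a , h) , nothing
  transition (a , just q)  (d , _) = respond a q d (δ q a)

  open Lists finCell
  open Transducer finState transition proj₁ (plain blank)

  passive : State
  passive = plain blank , nothing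

  -- A cell list is the tape read from left to right, up to blanks at both ends.

  unzip : List (Symbol symbols) → List Cell → List Cell
  unzip []       cs = cs
  unzip (l ∷ ls) cs = unzip ls (plain l ∷ cs)

  infix 4 _≈_

  data _≈_ : Config M → List Cell → Set where
    ⟨_,_⟩ : ∀ {q a ls ls⁺ rs rs⁺} → Padded ls ls⁺ → Padded rs rs⁺ →
            (q , tape ls a rs) ≈ unzip ls⁺ ((a , just q) ∷ List.map plain rs⁺)

  -- Right of the head the pending cell is written one position late and the blank read at the end
  -- fills the last place. Exposing the first cell `r` shows where an arriving head `h` lands.
  run-right : ∀ c h rs → ∃[ r ] ∃[ rs′ ] rs ∷ʳ blank ≡ r ∷ rs′ ×
              run (c , h) (List.map plain rs) ≡ c ∷ (r , h) ∷ List.map plain rs′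
  run-right c h []       = _ , _ , refl , refl
  run-right c h (r ∷ rs) with run-right (r , h) nothing rs
  ... | r′ , rs′ , eq , eq′ = _ , _ , refl , cong (c ∷_) (trans eq′ (cong (λ as → (r , h) ∷ List.map plain as) (sym eq)))

  run-plain : ∀ c rs → run (c , nothing) (List.map plain rs) ≡ c ∷ List.map plain (rs ∷ʳ blank)
  run-plain c rs with run-right c nothing rs
  ... | r , rs′ , eq , eq′ = trans eq′ (cong (λ as → c ∷ List.map plain as) (sym eq))

  -- The blank initially pending becomes the new leftmost cell, and the delay by one leaves the
  -- nearest left cell `l` pending when `cs` is reached.
  run-left : ∀ ls cs → ∃[ l ] ∃[ ls′ ] ls ∷ʳ blank ≡ l ∷ ls′ ×
             run passive (unzip ls cs) ≡ unzip ls′ (run (plain l , nothing) cs)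
  run-left []       cs = _ , _ , refl , refl
  run-left (l ∷ ls) cs with run-left ls (plain l ∷ cs)
  ... | l′ , ls′ , eq , eq′ = _ , _ , refl , trans eq′ (cong (λ as → unzip as (run (plain l , nothing) cs)) (sym eq))

  next? : Config M → Config M
  next? c = fromMaybe c (step M c)

  -- The list splits at the head: `run-left` handles the cells before it, `δ` the scanned cell, and
  -- `run-right` or `run-plain` the cells after it.
  simulate : ∀ {c cs} → c ≈ cs → next? c ≈ run passive cs
  simulate (⟨_,_⟩ {q} {a} {ls} {ls⁺} {rs} {rs⁺} pl pr)
    with run-left ls⁺ ((a , just q) ∷ List.map plain rs⁺) | Padded-∷ʳ pl | Padded-∷ʳ pr
  ... | l , ls′ , eq , eq′ | pl′ | pr′ rewrite eq′ | eq with δ q a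
  ... | nothing rewrite run-plain (a , just q) rs⁺ = ⟨ pl′ , pr′ ⟩
  ... | just (q′ , a′ , stay) rewrite run-plain (a′ , just q′) rs⁺ = ⟨ pl′ , pr′ ⟩
  ... | just (q′ , a′ , left) rewrite run-plain (plain a′) rs⁺ with pl′
  -- The tape ends here, and the blank that the machine creates is the padding; otherwise the head
  -- lands on a recorded cell.
  ...   | pad p = ⟨ p , a′ ∷ pr′ ⟩
  ...   | _ ∷ p = ⟨ p , a′ ∷ pr′ ⟩
  simulate (⟨_,_⟩ {q} {a} {ls} {ls⁺} {rs} {rs⁺} pl pr)
      | l , ls′ , eq , eq′ | pl′ | pr′ | just (q′ , a′ , right)
    with run-right (plain a′) (just q′) rs⁺
  ... | r , rs′ , eqr , eqr′ rewrite eqr′ | eqr with pr′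
  ...   | pad p = ⟨ a′ ∷ pl′ , p ⟩
  ...   | _ ∷ p = ⟨ a′ ∷ pl′ , p ⟩

  runs : ℕ → List Cell → List Cell
  runs zero    cs = cs
  runs (suc n) cs = run passive (runs n cs)

  runs-suc : ∀ n cs → runs (suc n) cs ≡ runs n (run passive cs)
  runs-suc zero    cs = refl
  runs-suc (suc n) cs = cong (run passive) (runs-suc n cs)

  -- A halted configuration is fixed by `next?`, so surplus steps only add blanks and any upper
  -- bound on the running time will do.
  runs-HaltsIn : ∀ {c n τ cs} → HaltsIn M c n τ → c ≈ cs → ∀ {m} → n ≤ m → ∃[ q ] (q , τ) ≈ runs m cs
  runs-HaltsIn (halt eq) p {zero}  _ = _ , p
  runs-HaltsIn {c} {cs = cs} (halt eq) p {suc m} _ rewrite runs-suc m cs =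
    runs-HaltsIn (halt eq) (subst (λ c′ → fromMaybe c c′ ≈ _) eq (simulate p)) {m} z≤n
  runs-HaltsIn {c} {cs = cs} (next go h) p {suc m} (s≤s n≤m) rewrite runs-suc m cs =
    runs-HaltsIn h (subst (λ c′ → fromMaybe c c′ ≈ _) go (simulate p)) n≤m

  -- Initial configuration and output.

  -- The head is treated as arriving from the left on the first letter. For the empty word it lands
  -- on the blank read at the end.
  entering : State
  entering = plain blank , just start

  run-entering : ∀ w → initial M w ≈ run entering (List.map (plain ∘ bit) w)
  run-entering []      = ⟨ pad [] , [] ⟩
  run-entering (b ∷ w) = subst (λ cs → initial M (b ∷ w) ≈ plain blank ∷ cs)
    (sym (trans (cong (run _) (List.map-∘ w)) (run-plain (bit b , just start) (List.map bit w))))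
    ⟨ pad [] , Padded-∷ʳ (Padded-refl (List.map bit w)) ⟩

  emitBit : Symbol symbols → Action
  emitBit (bit b) = emit b
  emitBit _       = stop

  -- The head mark tells where the output begins; from there on the flag is `true`, until the first
  -- symbol that is not a bit.
  act : Cell → Bool → Action
  act (a , nothing) false = skip
  act (a , _)       _     = emitBit a

  open Reader act

  read-plain : ∀ as → read (List.map plain as) true ≡ bits as
  read-plain []            = refl
  read-plain (blank ∷ as)  = refl
  read-plain (bit b ∷ as)  = cong (b ∷_) (read-plain as)
  read-plain (aux a ∷ as)  = refl

  read-unzip : ∀ ls cs → read (unzip ls cs) false ≡ read cs false
  read-unzip []       cs = refl
  read-unzip (l ∷ ls) cs = read-unzip ls (plain l ∷ cs)

  read-head : ∀ a q as → read ((a , just q) ∷ List.map plain as) false ≡ bits (a ∷ as)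
  read-head blank   q as = refl
  read-head (bit b) q as = cong (b ∷_) (read-plain as)
  read-head (aux a) q as = refl

  read-≈ : ∀ {q τ cs} → (q , τ) ≈ cs → read cs false ≡ output τ
  read-≈ (⟨_,_⟩ {q} {a} {ls⁺ = ls⁺} {rs⁺ = rs⁺} pl pr) =
    trans (read-unzip ls⁺ _) (trans (read-head a q rs⁺) (bits-Padded (a ∷ pr)))

  -- The simulation as a term.

  load : Tpl 0
  load = iter (inst (consL (plain (bit false)))) (inst (consL (plain (bit true)))) (list [])

  ⊢load : ∀ {k} → ∅ {k} ⊢ inst load ∶ W ⊸ § L
  ⊢load = ⊢iter (⊢consL (plain (bit false))) (⊢consL (plain (bit true))) ⊢nil

  load-↠ : ∀ w → inst load · church w ↠β list (List.map (plain ∘ bit) w)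
  load-↠ w = iter-↠ (inst (consL (plain (bit false)))) (inst (consL (plain (bit true)))) (list []) w ◅◅ go w
    where
    go : ∀ w → spine (if₀₁ (inst (consL (plain (bit false)))) (inst (consL (plain (bit true))))) (list []) w ↠β
               list (List.map (plain ∘ bit) w)
    go []          = ε
    go (false ∷ w) = ε ·↠ go w ◅◅ consL-↠ (plain (bit false)) (List.map (plain ∘ bit) w)
    go (true  ∷ w) = ε ·↠ go w ◅◅ consL-↠ (plain (bit true)) (List.map (plain ∘ bit) w)

  enter advance : Term 0
  enter   = inst (transduce entering)
  advance = inst (transduce passive)

  process : Tpl 0
  process = ƛ (ƛ (⌞ inst reader ⌟ · (v1 · (⌞ enter ⌟ · v0))))

  -- The second word only counts steps: both its letters act as `advance`. One § comes from the
  -- folds and one from `reader`.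
  simulator : Tpl 0
  simulator = ƛ (ƛ (⟪ η₂ process ⟫ · (v0 · ⌞ advance ⌟ · ⌞ advance ⌟) · (⌞ inst load ⌟ · v1)))

  ⊢simulator : ∀ {k} → ∅ {k} ⊢ inst simulator ∶ W ⊸ W ⊸ §^ 2 W
  ⊢simulator = ⊸i (⊸i (⊸e (left ∷ right ∷ [])
    (⊸e∅ (const (⊢η₂ {t = process} 1 (⊸i (⊸i (⊸e∅ (const ⊢reader)
        (⊸e (right ∷ left ∷ []) (Id _) (⊸e∅ (const (⊢transduce entering)) (Id _))))))))
      (⊢fold (Id _) (const (⊢transduce passive)) (const (⊢transduce passive))))
    (⊸e∅ (const ⊢load) (Id _))))

  simulator-↠ : ∀ w r → inst simulator · church w · church r ↠β
                church (read (runs (length r) (run entering (List.map (plain ∘ bit) w))) false)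
  simulator-↠ w r =
    reduce 9 (simulator · ⌞ church w ⌟ · ⌞ church r ⌟)
      (⌞ inst reader ⌟ · (⌞ church r ⌟ · ⌞ advance ⌟ · ⌞ advance ⌟ · (⌞ enter ⌟ · (⌞ inst load ⌟ · ⌞ church w ⌟)))) refl ◅◅
    ε ·↠ (ε ·↠ (ε ·↠ load-↠ w ◅◅ transduce-↠ entering (List.map (plain ∘ bit) w)) ◅◅
          church-↠ r advance advance (list cs) ◅◅ go r) ◅◅
    reader-↠ (runs (length r) cs)
    where
    cs : List Cell
    cs = run entering (List.map (plain ∘ bit) w)
    go : ∀ r → spine (if₀₁ advance advance) (list cs) r ↠β list (runs (length r) cs)
    go []          = ε
    go (false ∷ r) = ε ·↠ go r ◅◅ transduce-↠ passive (runs (length r) cs)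
    go (true  ∷ r) = ε ·↠ go r ◅◅ transduce-↠ passive (runs (length r) cs)

theorem20 : (f : Word → Word) → PolynomialTime f →
    Σ[ t ∈ Term 0 ] Σ[ n ∈ ℕ ] ((⊢DLAL t ∶ W ⊸ §^ n W) × t Represents f)
theorem20 f (M , p , computes) with clock p
-- The input goes to both the simulator and the clock. The § are two from `bind`, `n` from the clock
-- and two from the simulator.
... | t , n , ⊢t , ticks = inst (bind n (inst simulator) t) , 2 + (n + 2) ,
  subst (λ A → ∅ ⊢ inst (bind n (inst simulator) t) ∶ W ⊸ § § A) (§^-+ n 2)
    (⊢bind n (inst simulator) t ⊢simulator ⊢t) ,
  λ w → let
    v , tw , length-v = ticks w
    m , τ , m≤ , halts , out = computes w
    -- The length of the clock word is exactly the polynomial bound, hence at least the number `m`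
    -- of steps.
    _ , sim = runs-HaltsIn halts (run-entering w) (subst (m ≤_) (sym length-v) m≤)
    in bind-↠ n (inst simulator) t {u = v} w tw (simulator-↠ w v) ◅◅
       ≡⇒↠ (cong church (trans (read-≈ sim) out))
  where
  open Simulation M
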